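{- Every trihex can be produced (up to equivalence of trihexes) as the quotient of a tiling of the plane by regular hexagons under the group of isometries generated by the $180^\circ$ rotations around all the vertices of a superimposed parallelogram grid.
   Context: A trihex is a finite, connected, 3-regular planar graph, drawn in the plane regarded as part of the oriented sphere $S^2=\mathbb{R}^2\cup\{\infty\}$, whose faces (including the unbounded one) all have three or six sides. Two trihexes are equivalent if there is an orientation-preserving homeomorphism of the sphere taking one graph to the other. The hexagonal tiling is the tiling of the plane by regular hexagons arranged in vertical columns, two sides of each hexagon being horizontal. A superimposed parallelogram grid is a tiling of the plane by translated copies of a single parallelogram, meeting edge to edge so that the vertices form a (translated) lattice, such that every vertex of every parallelogram is the center of a hexagon of the tiling and every parallelogram has two vertical sides. Let $G$ be the group of isometries generated by the $180^\circ$ rotations around all the vertices of the grid. The tiling is preserved by $G$, the quotient of the plane by $G$ is a topological sphere (oriented by the orientation of the plane), and the vertices and edges of the tiling project to a graph on this sphere. This graph on the quotient sphere is what is meant by the quotient of the hexagonal tiling. -}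

module Defs where

open import Data.Fin.Base using (Fin)
open import Data.Integer.Base as ℤ using (ℤ; +_; -[1+_])
import Data.Integer.Properties as ℤ
open import Data.Integer.Tactic.RingSolver using (solve-∀)
open import Data.List.Base using (List; []; _∷_; _++_; [_]; foldr; reverse)
open import Data.List.Properties using (foldr-++; unfold-reverse)
open import Data.Nat.Base as ℕ using (ℕ; zero; suc)
import Data.Nat.Properties as ℕ
open import Data.Nat.GeneralisedArithmetic using (fold)
open import Data.Product.Base using (Σ; ∃-syntax; _×_; _,_; proj₁; proj₂)
open import Data.Sum.Base using (_⊎_)
open import Function.Bundles using (Inverse)
open import Level using (0ℓ)
open import Relation.Binary.Bundles using (Setoid)
open import Relation.Binary.Construct.Closure.Equivalence as EqC using (EqClosure)
open import Relation.Binary.PropositionalEquality as ≡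
  using (_≡_; _≢_; refl; sym; trans; cong; cong₂; module ≡-Reasoning)
open import Relation.Nullary.Negation using (¬_)

------------------------------------------------------------------------
-- Graphs drawn on oriented closed surfaces
--
-- A graph without isolated vertices whose complement in the surface is a
-- union of open discs is determined, up to orientation-preserving
-- homeomorphism, by its darts (oriented edges) together with
--   σ : the dart following d counterclockwise around the source of d,
--   α : the reverse of d.
-- Vertices, edges and faces are the orbits of σ, α and φ.  Darts form a
-- setoid so that quotient graphs can be expressed.  Loops and multiple
-- edges are not excluded.

record RotationSystem : Set₁ where
  field
    Dart : Setoid 0ℓ 0ℓ

  open Setoid Dart public
    using (_≈_)
    renaming (Carrier to ∣Dart∣)

  field
    rotation     : Inverse Dart Dart
    α            : ∣Dart∣ → ∣Dart∣
    α-cong       : ∀ {d e} → d ≈ e → α d ≈ α e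
    α-involutive : ∀ d → α (α d) ≈ d
    α-free       : ∀ d → ¬ (α d ≈ d)

  open Inverse rotation public
    using ()
    renaming (to to σ; from to σ⁻¹)

  -- The next dart along the boundary of the face on the left of d: at the
  -- head of d, the first dart clockwise from the reverse of d.
  φ : ∣Dart∣ → ∣Dart∣
  φ d = σ⁻¹ (α d)

  Orbits : (∣Dart∣ → ∣Dart∣) → Setoid 0ℓ 0ℓ
  Orbits f = EqC.setoid (λ d e → f d ≈ e)

  Vertices Edges Faces : Setoid 0ℓ 0ℓ
  Vertices = Orbits σ
  Edges    = Orbits α
  Faces    = Orbits φ

  OrbitSize : (∣Dart∣ → ∣Dart∣) → ∣Dart∣ → ℕ → Set
  OrbitSize f d k =
    fold d f k ≈ d × (∀ j → 0 ℕ.< j → j ℕ.< k → ¬ (fold d f j ≈ d))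

  Connected : Set
  Connected = ∀ d e → EqClosure (λ x y → (σ x ≈ y) ⊎ (α x ≈ y)) d e

HasSize : Setoid 0ℓ 0ℓ → ℕ → Set
HasSize S n = Inverse S (≡.setoid (Fin n))

-- For a connected rotation system the surface is the sphere exactly when
-- V - E + F = 2.  The number of sides of a face is the length of its
-- boundary walk.
record IsTrihex (M : RotationSystem) : Set where
  open RotationSystem M
  field
    finite     : ∃[ n ] HasSize Dart n
    connected  : Connected
    {V E F}    : ℕ
    #vertices  : HasSize Vertices V
    #edges     : HasSize Edges E
    #faces     : HasSize Faces F
    spherical  : V ℕ.+ F ≡ E ℕ.+ 2
    cubic      : ∀ d → OrbitSize σ d 3
    face-sides : ∀ d → OrbitSize φ d 3 ⊎ OrbitSize φ d 6

Trihex : Set₁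
Trihex = Σ RotationSystem IsTrihex

-- Commuting with σ, and not σ⁻¹, is what makes the underlying
-- homeomorphism orientation-preserving.
record Equivalent (M N : RotationSystem) : Set where
  private
    module M = RotationSystem M
    module N = RotationSystem N
  field
    darts : Inverse M.Dart N.Dart
  open Inverse darts using (to)
  field
    commutes-σ : ∀ d → to (M.σ d) N.≈ N.σ (to d)
    commutes-α : ∀ d → to (M.α d) N.≈ N.α (to d)

------------------------------------------------------------------------
-- The hexagonal tiling
--
-- The tiling has side length 1.  (a , b) stands for the point a + b ω of
-- the complex plane, ω = exp (2πi/3), whose Cartesian coordinates are
-- (a - b/2 , b √3/2).  The corners and centres of all the hexagons are of
-- this form.

Point : Set
Point = ℤ × ℤ

infixl 6 _⊕_ _⊖_
infixr 7 _·_

_⊕_ _⊖_ : Point → Point → Point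
(a , b) ⊕ (c , d) = a ℤ.+ c , b ℤ.+ d
(a , b) ⊖ (c , d) = a ℤ.- c , b ℤ.- d

_·_ : ℤ → Point → Point
n · (a , b) = n ℤ.* a , n ℤ.* b

det : Point → Point → ℤ
det (a , b) (c , d) = a ℤ.* d ℤ.- b ℤ.* c

-- Multiplication by ω, i.e. counterclockwise rotation by 120°.
ω* : Point → Point
ω* (a , b) = ℤ.- b , a ℤ.- b

-- Multiplication by ζ = 1 + ω = exp (πi/3), rotation by 60°.
ζ* : Point → Point
ζ* (a , b) = a ℤ.- b , a

-- Real part 0.
IsVertical : Point → Set
IsVertical (a , b) = + 2 ℤ.* a ≡ b

-- 2 + ω = (3/2 , √3/2) and 1 + 2ω = (0 , √3) translate a hexagon to its
-- upper right and its upper neighbour.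
IsCentre : Point → Set
IsCentre p = ∃[ k ] ∃[ m ] p ≡ k · (+ 2 , + 1) ⊕ m · (+ 1 , + 2)

-- ζᵏ.  The hexagon with centre c has the corners c ⊕ corner k, in
-- counterclockwise order; its side from ζ to ζ² is horizontal.
corner : ℕ → Point
corner k = fold (+ 1 , + 0) ζ* k

-- The segment from p to q is a side of a hexagon lying on its left.
IsSide : Point → Point → Set
IsSide p q = ∃[ c ] ∃[ k ]
  IsCentre c × p ≡ c ⊕ corner k × q ≡ c ⊕ corner (suc k)

record TilingDart : Set where
  constructor dart
  field
    source target : Point
    side          : IsSide source target
open TilingDart

IsCentre-step : ∀ {c} → IsCentre c → ∀ u → IsCentre (c ⊕ (u ⊕ ζ* u))
IsCentre-step (k , m , refl) (a , b) =
  k ℤ.+ (a ℤ.- b) , m ℤ.+ b , cong₂ _,_ (eq₁ k m a b) (eq₂ k m a b)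
  where
  eq₁ : ∀ k m a b → (k ℤ.* + 2 ℤ.+ m ℤ.* + 1) ℤ.+ (a ℤ.+ (a ℤ.- b))
      ≡ (k ℤ.+ (a ℤ.- b)) ℤ.* + 2 ℤ.+ (m ℤ.+ b) ℤ.* + 1
  eq₁ = solve-∀
  eq₂ : ∀ k m a b → (k ℤ.* + 1 ℤ.+ m ℤ.* + 2) ℤ.+ (b ℤ.+ a)
      ≡ (k ℤ.+ (a ℤ.- b)) ℤ.* + 1 ℤ.+ (m ℤ.+ b) ℤ.* + 2
  eq₂ = solve-∀

-- q rotated counterclockwise by 120° around p.
turn : Point → Point → Point
turn p q = p ⊕ ω* (q ⊖ p)

turn³ : ∀ p q → turn p (turn p (turn p q)) ≡ q
turn³ (a , b) (c , d) = cong₂ _,_ (eq₁ a b c d) (eq₂ a b c d)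
  where
  eq₁ : ∀ a b c d →
    let x₁ = a ℤ.+ (ℤ.- (d ℤ.- b)) ; y₁ = b ℤ.+ ((c ℤ.- a) ℤ.- (d ℤ.- b))
        x₂ = a ℤ.+ (ℤ.- (y₁ ℤ.- b)) ; y₂ = b ℤ.+ ((x₁ ℤ.- a) ℤ.- (y₁ ℤ.- b))
    in a ℤ.+ (ℤ.- (y₂ ℤ.- b)) ≡ c
  eq₁ = solve-∀
  eq₂ : ∀ a b c d →
    let x₁ = a ℤ.+ (ℤ.- (d ℤ.- b)) ; y₁ = b ℤ.+ ((c ℤ.- a) ℤ.- (d ℤ.- b))
        x₂ = a ℤ.+ (ℤ.- (y₁ ℤ.- b)) ; y₂ = b ℤ.+ ((x₁ ℤ.- a) ℤ.- (y₁ ℤ.- b))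
    in b ℤ.+ ((x₂ ℤ.- a) ℤ.- (y₂ ℤ.- b)) ≡ d
  eq₂ = solve-∀

flip-side : ∀ {p q} → IsSide p q → IsSide q p
flip-side {p} {q} ((x , y) , k , centre , refl , refl) with corner k in eq
... | u@(a , b) = (x , y) ⊕ (u ⊕ ζ* u) , 3 ℕ.+ k
    , IsCentre-step centre u , head , tail
  where
  head : (x , y) ⊕ ζ* u ≡ (x , y) ⊕ (u ⊕ ζ* u) ⊕ corner (3 ℕ.+ k)
  head rewrite eq = cong₂ _,_ (eq₁ x a b) (eq₂ y a b)
    where
    eq₁ : ∀ x a b → x ℤ.+ (a ℤ.- b)
        ≡ (x ℤ.+ (a ℤ.+ (a ℤ.- b))) ℤ.+ (((a ℤ.- b) ℤ.- a) ℤ.- (a ℤ.- b))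
    eq₁ = solve-∀
    eq₂ : ∀ y a b → y ℤ.+ a ≡ (y ℤ.+ (b ℤ.+ a)) ℤ.+ ((a ℤ.- b) ℤ.- a)
    eq₂ = solve-∀
  tail : (x , y) ⊕ u ≡ (x , y) ⊕ (u ⊕ ζ* u) ⊕ corner (4 ℕ.+ k)
  tail rewrite eq = cong₂ _,_ (eq₁ x a b) (eq₂ y a b)
    where
    eq₁ : ∀ x a b → x ℤ.+ a
        ≡ (x ℤ.+ (a ℤ.+ (a ℤ.- b)))
          ℤ.+ ((((a ℤ.- b) ℤ.- a) ℤ.- (a ℤ.- b)) ℤ.- ((a ℤ.- b) ℤ.- a))
    eq₁ = solve-∀
    eq₂ : ∀ y a b → y ℤ.+ b
        ≡ (y ℤ.+ (b ℤ.+ a)) ℤ.+ (((a ℤ.- b) ℤ.- a) ℤ.- (a ℤ.- b))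
    eq₂ = solve-∀

turn-side : ∀ {p q} → IsSide p q → IsSide p (turn p q)
turn-side {p} {q} ((x , y) , k , centre , refl , refl) with corner k in eq
... | u@(a , b) = (x , y) ⊕ (v ⊕ ζ* v) , 2 ℕ.+ k
    , IsCentre-step centre v , tail , head
  where
  v : Point
  v = b , b ℤ.- a
  tail : (x , y) ⊕ u ≡ (x , y) ⊕ (v ⊕ ζ* v) ⊕ corner (2 ℕ.+ k)
  tail rewrite eq = cong₂ _,_ (eq₁ x a b) (eq₂ y a b)
    where
    eq₁ : ∀ x a b → x ℤ.+ a
        ≡ (x ℤ.+ (b ℤ.+ (b ℤ.- (b ℤ.- a)))) ℤ.+ ((a ℤ.- b) ℤ.- a)
    eq₁ = solve-∀
    eq₂ : ∀ y a b → y ℤ.+ b ≡ (y ℤ.+ ((b ℤ.- a) ℤ.+ b)) ℤ.+ (a ℤ.- b)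
    eq₂ = solve-∀
  head : turn ((x , y) ⊕ u) ((x , y) ⊕ ζ* u)
       ≡ (x , y) ⊕ (v ⊕ ζ* v) ⊕ corner (3 ℕ.+ k)
  head rewrite eq = cong₂ _,_ (eq₁ x y a b) (eq₂ x y a b)
    where
    eq₁ : ∀ x y a b → (x ℤ.+ a) ℤ.+ (ℤ.- ((y ℤ.+ a) ℤ.- (y ℤ.+ b)))
        ≡ (x ℤ.+ (b ℤ.+ (b ℤ.- (b ℤ.- a))))
          ℤ.+ (((a ℤ.- b) ℤ.- a) ℤ.- (a ℤ.- b))
    eq₁ = solve-∀
    eq₂ : ∀ x y a b → (y ℤ.+ b)
          ℤ.+ (((x ℤ.+ (a ℤ.- b)) ℤ.- (x ℤ.+ a)) ℤ.- ((y ℤ.+ a) ℤ.- (y ℤ.+ b)))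
        ≡ (y ℤ.+ ((b ℤ.- a) ℤ.+ b)) ℤ.+ ((a ℤ.- b) ℤ.- a)
    eq₂ = solve-∀

turnDart : TilingDart → TilingDart
turnDart (dart p q s) = dart p (turn p q) (turn-side s)

flipDart : TilingDart → TilingDart
flipDart (dart p q s) = dart q p (flip-side s)

------------------------------------------------------------------------
-- Superimposed parallelogram grids

-- The parallelograms are the translates by i · u ⊕ j · w (i, j ∈ ℤ) of the
-- parallelogram at origin spanned by u and w.
record ParallelogramGrid : Set where
  field
    origin u w    : Point
    nondegenerate : det u w ≢ + 0
    w-vertical    : IsVertical w

  vertex : ℤ × ℤ → Point
  vertex (i , j) = origin ⊕ (i · u ⊕ j · w)

  field
    centred : ∀ ij → IsCentre (vertex ij)

halfTurn : Point → Point → Point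
halfTurn c p = c ⊕ c ⊖ p

module _ (P : ParallelogramGrid) where
  open ParallelogramGrid P

  -- The elements of the group G generated by the half-turns around the grid
  -- vertices, as products of generators; each generator is its own inverse.
  act : List (ℤ × ℤ) → Point → Point
  act g p = foldr (λ ij → halfTurn (vertex ij)) p g

  SameOrbit : TilingDart → TilingDart → Set
  SameOrbit d e =
    ∃[ g ] act g (source d) ≡ source e × act g (target d) ≡ target e

  halfTurn² : ∀ c p → halfTurn c (halfTurn c p) ≡ p
  halfTurn² (a , b) (x , y) = cong₂ _,_ (eq a x) (eq b y)
    where
    eq : ∀ a x → (a ℤ.+ a) ℤ.- ((a ℤ.+ a) ℤ.- x) ≡ x
    eq = solve-∀

  act-++ : ∀ g h p → act (g ++ h) p ≡ act g (act h p)
  act-++ g h p = foldr-++ _ p g h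

  act-reverse : ∀ g p → act (reverse g) (act g p) ≡ p
  act-reverse []       p = refl
  act-reverse (ij ∷ g) p = begin
    act (reverse (ij ∷ g)) q         ≡⟨ cong (λ h → act h q) (unfold-reverse ij g) ⟩
    act (reverse g ++ [ ij ]) q      ≡⟨ act-++ (reverse g) [ ij ] q ⟩
    act (reverse g) (act [ ij ] q)   ≡⟨ cong (act (reverse g)) (halfTurn² (vertex ij) (act g p)) ⟩
    act (reverse g) (act g p)        ≡⟨ act-reverse g p ⟩
    p                                ∎
    where
    open ≡-Reasoning
    q : Point
    q = act (ij ∷ g) p

  halfTurn-turn : ∀ c p q →
    halfTurn c (turn p q) ≡ turn (halfTurn c p) (halfTurn c q)
  halfTurn-turn (m , n) (a , b) (x , y) =
    cong₂ _,_ (eq₁ m n a b y) (eq₂ m n a b x y)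
    where
    eq₁ : ∀ m n a b y → (m ℤ.+ m) ℤ.- (a ℤ.+ (ℤ.- (y ℤ.- b)))
        ≡ ((m ℤ.+ m) ℤ.- a) ℤ.+ (ℤ.- (((n ℤ.+ n) ℤ.- y) ℤ.- ((n ℤ.+ n) ℤ.- b)))
    eq₁ = solve-∀
    eq₂ : ∀ m n a b x y →
        (n ℤ.+ n) ℤ.- (b ℤ.+ ((x ℤ.- a) ℤ.- (y ℤ.- b)))
        ≡ ((n ℤ.+ n) ℤ.- b)
          ℤ.+ ((((m ℤ.+ m) ℤ.- x) ℤ.- ((m ℤ.+ m) ℤ.- a))
               ℤ.- (((n ℤ.+ n) ℤ.- y) ℤ.- ((n ℤ.+ n) ℤ.- b)))
    eq₂ = solve-∀

  act-turn : ∀ g p q → act g (turn p q) ≡ turn (act g p) (act g q)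
  act-turn []       p q = refl
  act-turn (ij ∷ g) p q = trans (cong (halfTurn (vertex ij)) (act-turn g p q))
    (halfTurn-turn (vertex ij) (act g p) (act g q))

  SameOrbit-reflexive : ∀ {d e} → source d ≡ source e → target d ≡ target e → SameOrbit d e
  SameOrbit-reflexive p q = [] , p , q

  SameOrbit-sym : ∀ {d e} → SameOrbit d e → SameOrbit e d
  SameOrbit-sym {d} {e} (g , p , q) = reverse g
    , trans (cong (act (reverse g)) (sym p)) (act-reverse g (source d))
    , trans (cong (act (reverse g)) (sym q)) (act-reverse g (target d))

  SameOrbit-trans : ∀ {d e f} → SameOrbit d e → SameOrbit e f → SameOrbit d f
  SameOrbit-trans {d} (g , p , q) (h , r , s) = h ++ g
    , trans (act-++ h g (source d)) (trans (cong (act h) p) r)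
    , trans (act-++ h g (target d)) (trans (cong (act h) q) s)

  turn-cong : ∀ {d e} → SameOrbit d e → SameOrbit (turnDart d) (turnDart e)
  turn-cong {d} (g , p , q) =
    g , p , trans (act-turn g (source d) (target d)) (cong₂ turn p q)

  turn³≈ : ∀ d → SameOrbit (turnDart (turnDart (turnDart d))) d
  turn³≈ d = SameOrbit-reflexive {turnDart (turnDart (turnDart d))} {d}
    refl (turn³ (source d) (target d))

  -- G preserves coordinates modulo 2, whereas the ends of a side differ
  -- modulo 2; hence no edge is folded by G.
  Even : Point → Set
  Even p = ∃[ r ] p ≡ r ⊕ r

  halfTurn-even : ∀ c p p′ → Even (p′ ⊖ p) → Even (halfTurn c p′ ⊖ p)
  halfTurn-even (a , b) (x , y) (x′ , y′) ((r , s) , eq) =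
    (a ℤ.- x ℤ.- r , b ℤ.- y ℤ.- s)
    , cong₂ _,_ (lemma a x x′ r (cong proj₁ eq)) (lemma b y y′ s (cong proj₂ eq))
    where
    open ≡-Reasoning
    split : ∀ a x x′ → ((a ℤ.+ a) ℤ.- x′) ℤ.- x ≡ (a ℤ.+ a) ℤ.- (x ℤ.+ x) ℤ.- (x′ ℤ.- x)
    split = solve-∀
    double : ∀ a x r → (a ℤ.+ a) ℤ.- (x ℤ.+ x) ℤ.- (r ℤ.+ r)
           ≡ (a ℤ.- x ℤ.- r) ℤ.+ (a ℤ.- x ℤ.- r)
    double = solve-∀
    lemma : ∀ a x x′ r → x′ ℤ.- x ≡ r ℤ.+ r →
      ((a ℤ.+ a) ℤ.- x′) ℤ.- x ≡ (a ℤ.- x ℤ.- r) ℤ.+ (a ℤ.- x ℤ.- r)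
    lemma a x x′ r e = begin
      ((a ℤ.+ a) ℤ.- x′) ℤ.- x                    ≡⟨ split a x x′ ⟩
      (a ℤ.+ a) ℤ.- (x ℤ.+ x) ℤ.- (x′ ℤ.- x)      ≡⟨ cong (λ z → (a ℤ.+ a) ℤ.- (x ℤ.+ x) ℤ.- z) e ⟩
      (a ℤ.+ a) ℤ.- (x ℤ.+ x) ℤ.- (r ℤ.+ r)       ≡⟨ double a x r ⟩
      (a ℤ.- x ℤ.- r) ℤ.+ (a ℤ.- x ℤ.- r)         ∎

  act-even : ∀ g p → Even (act g p ⊖ p)
  act-even []       (x , y) = (+ 0 , + 0) , cong₂ _,_ (ℤ.+-inverseʳ x) (ℤ.+-inverseʳ y)
  act-even (ij ∷ g) p       = halfTurn-even (vertex ij) p (act g p) (act-even g p)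

  1-odd : ∀ r → + 1 ≢ r ℤ.+ r
  1-odd (+ zero)   ()
  1-odd (+ suc n)  eq with trans (ℕ.suc-injective (ℤ.+-injective eq)) (ℕ.+-suc n n)
  ... | ()
  1-odd (-[1+ n ]) ()

  corner-odd : ∀ k → ¬ Even (corner k)
  corner-odd zero    ((r , s) , eq) = 1-odd r (cong proj₁ eq)
  corner-odd (suc k) ((r , s) , eq) = corner-odd k ((s , s ℤ.- r) ,
    cong₂ _,_ (cong proj₂ eq)
      (trans (recover (proj₁ (corner k)) (proj₂ (corner k)))
        (trans (cong₂ ℤ._-_ (cong proj₂ eq) (cong proj₁ eq)) (double r s))))
    where
    recover : ∀ a b → b ≡ a ℤ.- (a ℤ.- b)
    recover = solve-∀
    double : ∀ r s → (s ℤ.+ s) ℤ.- (r ℤ.+ r) ≡ (s ℤ.- r) ℤ.+ (s ℤ.- r)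
    double = solve-∀

  side-odd : ∀ {p q} → IsSide p q → ¬ Even (p ⊖ q)
  side-odd ((x , y) , k , _ , refl , refl) (r , eq) =
    corner-odd (5 ℕ.+ k) (r , trans (sym (difference x y (corner k))) eq)
    where
    difference : ∀ x y u → ((x , y) ⊕ u) ⊖ ((x , y) ⊕ ζ* u) ≡ ζ* (ζ* (ζ* (ζ* (ζ* u))))
    difference x y (a , b) = cong₂ _,_ (eq₁ x a b) (eq₂ y a b)
      where
      eq₁ : ∀ x a b →
        let a₂ = (a ℤ.- b) ℤ.- a ; a₃ = a₂ ℤ.- (a ℤ.- b) ; a₄ = a₃ ℤ.- a₂
        in (x ℤ.+ a) ℤ.- (x ℤ.+ (a ℤ.- b)) ≡ a₄ ℤ.- a₃
      eq₁ = solve-∀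
      eq₂ : ∀ y a b →
        let a₂ = (a ℤ.- b) ℤ.- a ; a₃ = a₂ ℤ.- (a ℤ.- b)
        in (y ℤ.+ b) ℤ.- (y ℤ.+ a) ≡ a₃ ℤ.- a₂
      eq₂ = solve-∀

  flip-free : ∀ d → ¬ SameOrbit (flipDart d) d
  flip-free (dart p q s) (g , q↦p , _) =
    side-odd s (≡.subst (λ x → Even (x ⊖ q)) q↦p (act-even g q))

  -- The graph on the quotient sphere.  G preserves orientation and its
  -- non-trivial elements fix no point of the tiling's vertices and edges, so
  -- the darts of the quotient graph are the G-orbits of darts of the tiling,
  -- with the induced rotation.
  quotient : RotationSystem
  quotient = record
    { Dart = record
      { Carrier       = TilingDart
      ; _≈_           = SameOrbit
      ; isEquivalence = record
        { refl  = λ {d} → SameOrbit-reflexive {d} {d} refl refl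
        ; sym   = λ {d} {e} → SameOrbit-sym {d} {e}
        ; trans = λ {d} {e} {f} → SameOrbit-trans {d} {e} {f}
        }
      }
    ; rotation = record
      { to        = turnDart
      ; from      = λ d → turnDart (turnDart d)
      ; to-cong   = λ {d} {e} → turn-cong {d} {e}
      ; from-cong = λ {d} {e} d≈e →
          turn-cong {turnDart d} {turnDart e} (turn-cong {d} {e} d≈e)
      ; inverse   =
          (λ {d} {e} e≈ → SameOrbit-trans {turnDart e} {turnDart (turnDart (turnDart d))} {d}
            (turn-cong {e} {turnDart (turnDart d)} e≈) (turn³≈ d))
        , (λ {d} {e} e≈ → SameOrbit-trans
            {turnDart (turnDart e)} {turnDart (turnDart (turnDart d))} {d}
            (turn-cong {turnDart e} {turnDart (turnDart d)} (turn-cong {e} {turnDart d} e≈))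
            (turn³≈ d))
      }
    ; α            = flipDart
    ; α-cong       = λ (g , p , q) → g , q , p
    ; α-involutive = λ d → SameOrbit-reflexive {flipDart (flipDart d)} {d} refl refl
    ; α-free       = flip-free
    }

{-# OPTIONS --safe #-}

-- In a cubic map with faces of 3 or 6 sides, σ³ = α² = φ⁶ = 1, which are the
-- relations of the rotation group of the hexagonal tiling; so this group acts
-- on the darts of the trihex and the tiling covers the trihex.  By Euler's
-- formula there is a triangle, around whose preimages the covering is
-- invariant under half-turns.  A deck rotation by 60°, or one by 120° composed
-- with such a half-turn, would give a face with one side, and a half-turn around
-- the midpoint of a side would give a folded edge, so the deck group consists of
-- translations and of half-turns around hexagon centres.  The centres of these
-- half-turns form a lattice of rank 2, whose Hermite normal form supplies a basis
-- with a vertical vector.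
module Submission where

open import Defs
open import Data.Fin.Base as Fin using (Fin; toℕ; fromℕ<)
import Data.Fin.Properties as Fin
open import Data.Integer.Base as ℤ using (ℤ; +_; -[1+_])
import Data.Integer.DivMod as ℤ
import Data.Integer.Properties as ℤ
open import Data.Integer.Tactic.RingSolver using (solve-∀)
open import Algebra.Properties.AbelianGroup ℤ.+-0-abelianGroup using (∙-cancelʳ)
open import Data.List.Base using (List; []; _∷_)
open import Data.Nat.Base as ℕ using (ℕ; zero; suc)
import Data.Nat.DivMod as ℕ
open import Data.Nat.GeneralisedArithmetic using (fold; fold-+)
open import Data.Nat.Induction using (<-rec)
import Data.Nat.Properties as ℕ
open import Data.Nat.Tactic.RingSolver using () renaming (solve-∀ to ℕsolve-∀)
open import Data.Product.Base using (∃-syntax; _×_; _,_; proj₁; proj₂; uncurry)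
open import Data.Sum.Base using (_⊎_; inj₁; inj₂)
open import Function.Bundles using (Inverse; _↔_; mk↔ₛ′)
open import Level using (0ℓ)
open import Relation.Binary.Bundles using (Setoid)
open import Relation.Binary.Construct.Closure.Equivalence as EqC using (EqClosure)
open import Relation.Binary.Construct.Closure.ReflexiveTransitive using (ε; _◅_)
open import Relation.Binary.Construct.Closure.Symmetric using (fwd; bwd)
open import Relation.Binary.PropositionalEquality
  using (_≡_; _≢_; refl; sym; trans; cong; cong₂; subst; module ≡-Reasoning)
open import Relation.Nullary.Decidable using (yes; no; map′)
open import Relation.Nullary.Negation using (¬_; contradiction)
open import Relation.Unary using (Decidable)
open ≡-Reasoning

-- Subgroups of ℤ

Closed : (ℤ → Set) → Set
Closed P = ∀ x y → P x → P y → P (x ℤ.- y)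

module _ {P : ℤ → Set} (closed : Closed P) where

  multiples : ∀ x → P x → ∀ j → P (j ℤ.* x)
  multiples x Px = go
    where
    0∈ : P (+ 0)
    0∈ = subst P (ℤ.+-inverseʳ x) (closed x x Px Px)
    neg : ∀ y → P y → P (ℤ.- y)
    neg y Py = subst P (ℤ.+-identityˡ (ℤ.- y)) (closed (+ 0) y 0∈ Py)
    next : ∀ n x → x ℤ.- (ℤ.- (n ℤ.* x)) ≡ (+ 1 ℤ.+ n) ℤ.* x
    next = solve-∀
    nonneg : ∀ n → P (+ n ℤ.* x)
    nonneg zero    = 0∈
    nonneg (suc n) = subst P (next (+ n) x) (closed x (ℤ.- (+ n ℤ.* x)) Px (neg (+ n ℤ.* x) (nonneg n)))
    go : ∀ j → P (j ℤ.* x)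
    go (+ n)    = nonneg n
    go -[1+ n ] = subst P (ℤ.neg-distribˡ-* (+ suc n) x) (neg (+ suc n ℤ.* x) (nonneg (suc n)))

  remainder : ∀ m → P (+ suc m) → ∀ z → P z → P (+ (z ℤ.%ℕ suc m))
  remainder m Pm z Pz = subst P
    (trans (cong (λ t → t ℤ.- q) (ℤ.a≡a%ℕn+[a/ℕn]*n z (suc m))) (cancel _ q))
    (closed z q Pz (multiples (+ suc m) Pm (z ℤ./ℕ suc m)))
    where
    q : ℤ
    q = (z ℤ./ℕ suc m) ℤ.* + suc m
    cancel : ∀ r q → (r ℤ.+ q) ℤ.- q ≡ r
    cancel = solve-∀

  Generated : Set
  Generated = ∃[ m ] P (+ suc m) × (∀ z → P z → ∃[ j ] z ≡ j ℤ.* + suc m)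

  -- Descent to the least positive element: the finitely many smaller candidates are searched, and
  -- once none is left every remainder modulo `suc m`, being an element itself, must be 0.
  generated : Decidable P → ∀ m → P (+ suc m) → Generated
  generated P? = <-rec (λ m → P (+ suc m) → Generated) step
    where
    step : ∀ m → (∀ {i} → i ℕ.< m → P (+ suc i) → Generated) → P (+ suc m) → Generated
    step m rec Pm with Fin.any? {n = m} (λ i → P? (+ suc (toℕ i)))
    ... | yes (i , Pi) = rec (Fin.toℕ<n i) Pi
    ... | no none      = m , Pm , λ z Pz →
      z ℤ./ℕ suc m , trans (ℤ.a≡a%ℕn+[a/ℕn]*n z (suc m))
        (trans (cong (λ r → + r ℤ.+ (z ℤ./ℕ suc m) ℤ.* + suc m)
                 (vanishes _ (ℤ.n%ℕd<d z (suc m)) (remainder m Pm z Pz)))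
          (ℤ.+-identityˡ _))
      where
      vanishes : ∀ r → r ℕ.< suc m → P (+ r) → r ≡ 0
      vanishes zero    _             _  = refl
      vanishes (suc r) (ℕ.s≤s r<m) Pr = contradiction
        (fromℕ< r<m , subst (λ i → P (+ suc i)) (sym (Fin.toℕ-fromℕ< r<m)) Pr) none

parity : ∀ z → (∃[ t ] z ≡ t ℤ.+ t) ⊎ (∃[ t ] z ≡ + 1 ℤ.+ (t ℤ.+ t))
parity z with z ℤ.%ℕ 2 | ℤ.n%ℕd<d z 2 | ℤ.a≡a%ℕn+[a/ℕn]*n z 2
... | 0 | _ | eq = inj₁ (t , trans eq (even t))
  where
  t : ℤ
  t = z ℤ./ℕ 2
  even : ∀ t → + 0 ℤ.+ t ℤ.* + 2 ≡ t ℤ.+ t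
  even = solve-∀
... | 1 | _ | eq = inj₂ (t , trans eq (odd t))
  where
  t : ℤ
  t = z ℤ./ℕ 2
  odd : ∀ t → + 1 ℤ.+ t ℤ.* + 2 ≡ + 1 ℤ.+ (t ℤ.+ t)
  odd = solve-∀
... | suc (suc _) | ℕ.s≤s (ℕ.s≤s ()) | _

-- Actions of ℤ

fold-suc : ∀ {A : Set} (f : A → A) x k → fold (f x) f k ≡ f (fold x f k)
fold-suc f x zero    = refl
fold-suc f x (suc k) = cong f (fold-suc f x k)

record IsAction {A : Set} (F : ℤ → A → A) : Set where
  field
    identity : ∀ x → F (+ 0) x ≡ x
    compose  : ∀ m n x → F (m ℤ.+ n) x ≡ F m (F n x)

module _ {A : Set} (p : A ↔ A) where
  open Inverse p using (to; from; strictlyInverseˡ; strictlyInverseʳ)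

  pow : ℤ → A → A
  pow (+ n)    x = fold x to n
  pow -[1+ n ] x = fold x from (suc n)

  pow-suc : ∀ z x → pow (ℤ.suc z) x ≡ to (pow z x)
  pow-suc (+ n)          x = refl
  pow-suc -[1+ zero ]  x = sym (strictlyInverseˡ x)
  pow-suc -[1+ suc n ] x = sym (strictlyInverseˡ _)

  pow-pred : ∀ z x → pow (ℤ.pred z) x ≡ from (pow z x)
  pow-pred (+ zero)    x = refl
  pow-pred (+ suc n)  x = sym (strictlyInverseʳ _)
  pow-pred -[1+ n ] x = refl

  pow-+ : ∀ m n x → pow (m ℤ.+ n) x ≡ pow m (pow n x)
  pow-+ (+ zero) n x = cong (λ z → pow z x) (ℤ.+-identityˡ n)
  pow-+ (+ suc m) n x = begin
    pow (+ suc m ℤ.+ n) x          ≡⟨ cong (λ z → pow z x) (ℤ.+-assoc (+ 1) (+ m) n) ⟩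
    pow (ℤ.suc (+ m ℤ.+ n)) x      ≡⟨ pow-suc (+ m ℤ.+ n) x ⟩
    to (pow (+ m ℤ.+ n) x)         ≡⟨ cong to (pow-+ (+ m) n x) ⟩
    to (pow (+ m) (pow n x))       ∎
  pow-+ -[1+ zero ] n x = pow-pred n x
  pow-+ -[1+ suc m ] n x = begin
    pow (-[1+ suc m ] ℤ.+ n) x     ≡⟨ cong (λ z → pow z x) (ℤ.+-assoc -[1+ 0 ] -[1+ m ] n) ⟩
    pow (ℤ.pred (-[1+ m ] ℤ.+ n)) x ≡⟨ pow-pred (-[1+ m ] ℤ.+ n) x ⟩
    from (pow (-[1+ m ] ℤ.+ n) x)  ≡⟨ cong from (pow-+ -[1+ m ] n x) ⟩
    from (pow -[1+ m ] (pow n x))  ∎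

  pow-isAction : IsAction pow
  pow-isAction = record { identity = λ _ → refl ; compose = pow-+ }

  -- Checking the generator is enough. `F` is an arbitrary action, so that it can also be the
  -- translations along a line and not only the powers of one permutation.
  pow-intertwines : ∀ {F} → IsAction F → ∀ {h : A → A} →
    (∀ x → h (to x) ≡ F (+ 1) (h x)) → ∀ z x → h (pow z x) ≡ F z (h x)
  pow-intertwines {F} isAction {h} h-to = go
    where
    open IsAction isAction
    h-from : ∀ x → h (from x) ≡ F -[1+ 0 ] (h x)
    h-from x = begin
      h (from x)                               ≡⟨ identity _ ⟨
      F (+ 0) (h (from x))                     ≡⟨ compose -[1+ 0 ] (+ 1) _ ⟩
      F -[1+ 0 ] (F (+ 1) (h (from x)))        ≡⟨ cong (F -[1+ 0 ]) (h-to (from x)) ⟨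
      F -[1+ 0 ] (h (to (from x)))
        ≡⟨ cong (λ y → F -[1+ 0 ] (h y)) (strictlyInverseˡ x) ⟩
      F -[1+ 0 ] (h x)                         ∎
    go : ∀ z x → h (pow z x) ≡ F z (h x)
    go (+ zero)  x = sym (identity _)
    go (+ suc n) x = begin
      h (to (fold x to n))      ≡⟨ h-to _ ⟩
      F (+ 1) (h (fold x to n)) ≡⟨ cong (F (+ 1)) (go (+ n) x) ⟩
      F (+ 1) (F (+ n) (h x))   ≡⟨ compose (+ 1) (+ n) _ ⟨
      F (+ suc n) (h x)         ∎
    go -[1+ zero ] x = h-from x
    go -[1+ suc n ] x = begin
      h (from (fold x from (suc n)))        ≡⟨ h-from _ ⟩
      F -[1+ 0 ] (h (fold x from (suc n)))  ≡⟨ cong (F -[1+ 0 ]) (go -[1+ n ] x) ⟩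
      F -[1+ 0 ] (F -[1+ n ] (h x))         ≡⟨ compose -[1+ 0 ] -[1+ n ] _ ⟨
      F -[1+ suc n ] (h x)                  ∎

pow-commute : ∀ {A : Set} (p q : A ↔ A) →
  (∀ x → Inverse.to p (Inverse.to q x) ≡ Inverse.to q (Inverse.to p x)) →
  ∀ m n x → pow p m (pow q n x) ≡ pow q n (pow p m x)
pow-commute p q comm m n x = sym (pow-intertwines p (pow-isAction p)
  (λ x → sym (pow-intertwines q (pow-isAction q) comm n x)) m x)

-- The corners of a hexagon

-- (x , y) are the coordinates of a centre in the basis 2 + ω, 1 + 2ω.
centre : Point → Point
centre (x , y) = x · (+ 2 , + 1) ⊕ y · (+ 1 , + 2)

opposite : Point → Point
opposite (a , b) = ℤ.- a , ℤ.- b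

-- Since corner k + corner (k + 1) = (1 + ζ) ζᵏ, this is the step from a hexagon
-- to its neighbour across its side k.
across : ℕ → Point
across k = proj₁ (corner k) ℤ.- proj₂ (corner k) , proj₂ (corner k)

corner-3 : ∀ k → corner (3 ℕ.+ k) ≡ opposite (corner k)
corner-3 k = let a , b = corner k in cong₂ _,_ (eq₁ a b) (eq₂ a b)
  where
  eq₁ : ∀ a b → ((a ℤ.- b) ℤ.- a) ℤ.- (a ℤ.- b) ≡ ℤ.- a
  eq₁ = solve-∀
  eq₂ : ∀ a b → (a ℤ.- b) ℤ.- a ≡ ℤ.- b
  eq₂ = solve-∀

corner-6 : ∀ k → corner (6 ℕ.+ k) ≡ corner k
corner-6 k = trans (corner-3 (3 ℕ.+ k)) (trans (cong opposite (corner-3 k))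
  (cong₂ _,_ (ℤ.neg-involutive _) (ℤ.neg-involutive _)))

corner-*6 : ∀ m k → corner (m ℕ.* 6 ℕ.+ k) ≡ corner k
corner-*6 zero    k = refl
corner-*6 (suc m) k = trans (corner-6 (m ℕ.* 6 ℕ.+ k)) (corner-*6 m k)

centre-across : ∀ k → centre (across k) ≡ corner k ⊕ corner (suc k)
centre-across k = let a , b = corner k in cong₂ _,_ (eq₁ a b) (eq₂ a b)
  where
  eq₁ : ∀ a b → (a ℤ.- b) ℤ.* + 2 ℤ.+ b ℤ.* + 1 ≡ a ℤ.+ (a ℤ.- b)
  eq₁ = solve-∀
  eq₂ : ∀ a b → (a ℤ.- b) ℤ.* + 1 ℤ.+ b ℤ.* + 2 ≡ b ℤ.+ a
  eq₂ = solve-∀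

centre-⊕ : ∀ v w → centre (v ⊕ w) ≡ centre v ⊕ centre w
centre-⊕ (x , y) (x′ , y′) = cong₂ _,_ (eq₁ x y x′ y′) (eq₂ x y x′ y′)
  where
  eq₁ : ∀ x y x′ y′ → (x ℤ.+ x′) ℤ.* + 2 ℤ.+ (y ℤ.+ y′) ℤ.* + 1
      ≡ (x ℤ.* + 2 ℤ.+ y ℤ.* + 1) ℤ.+ (x′ ℤ.* + 2 ℤ.+ y′ ℤ.* + 1)
  eq₁ = solve-∀
  eq₂ : ∀ x y x′ y′ → (x ℤ.+ x′) ℤ.* + 1 ℤ.+ (y ℤ.+ y′) ℤ.* + 2
      ≡ (x ℤ.* + 1 ℤ.+ y ℤ.* + 2) ℤ.+ (x′ ℤ.* + 1 ℤ.+ y′ ℤ.* + 2)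
  eq₂ = solve-∀

centre-opposite : ∀ v → centre (opposite v) ≡ opposite (centre v)
centre-opposite (x , y) = cong₂ _,_ (eq₁ x y) (eq₂ x y)
  where
  eq₁ : ∀ x y → (ℤ.- x) ℤ.* + 2 ℤ.+ (ℤ.- y) ℤ.* + 1 ≡ ℤ.- (x ℤ.* + 2 ℤ.+ y ℤ.* + 1)
  eq₁ = solve-∀
  eq₂ : ∀ x y → (ℤ.- x) ℤ.* + 1 ℤ.+ (ℤ.- y) ℤ.* + 2 ≡ ℤ.- (x ℤ.* + 1 ℤ.+ y ℤ.* + 2)
  eq₂ = solve-∀

-- The vectors 2 + ω and 1 + 2ω have determinant 3, so the linear system is solved up to a factor 3,
-- which is then cancelled.
centre-injective : ∀ v w → centre v ≡ centre w → v ≡ w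
centre-injective (x , y) (x′ , y′) eq = cong₂ _,_
  (ℤ.*-cancelʳ-≡ x x′ (+ 3) (trans (sym (solve₁ x y))
    (trans (cong₂ (λ s t → (s ℤ.+ s) ℤ.- t) (cong proj₁ eq) (cong proj₂ eq)) (solve₁ x′ y′))))
  (ℤ.*-cancelʳ-≡ y y′ (+ 3) (trans (sym (solve₂ x y))
    (trans (cong₂ (λ s t → (t ℤ.+ t) ℤ.- s) (cong proj₁ eq) (cong proj₂ eq)) (solve₂ x′ y′))))
  where
  solve₁ : ∀ x y → let s = x ℤ.* + 2 ℤ.+ y ℤ.* + 1 ; t = x ℤ.* + 1 ℤ.+ y ℤ.* + 2
    in (s ℤ.+ s) ℤ.- t ≡ x ℤ.* + 3
  solve₁ = solve-∀
  solve₂ : ∀ x y → let s = x ℤ.* + 2 ℤ.+ y ℤ.* + 1 ; t = x ℤ.* + 1 ℤ.+ y ℤ.* + 2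
    in (t ℤ.+ t) ℤ.- s ≡ y ℤ.* + 3
  solve₂ = solve-∀

⊕-cancelʳ : ∀ p q r → p ⊕ r ≡ q ⊕ r → p ≡ q
⊕-cancelʳ (a , b) (c , d) (x , y) eq = cong₂ _,_
  (∙-cancelʳ x a c (cong proj₁ eq)) (∙-cancelʳ y b d (cong proj₂ eq))

-- The side k of a hexagon points in the direction ζᵏ⁺².
side-unique : ∀ v w k l → centre v ⊕ corner k ≡ centre w ⊕ corner l →
  centre v ⊕ corner (suc k) ≡ centre w ⊕ corner (suc l) → v ≡ w × corner k ≡ corner l
side-unique v w k l p q = centre-injective v w
    (⊕-cancelʳ (centre v) (centre w) (corner l) (trans (cong (centre v ⊕_) (sym same)) p))
  , same
  where
  -- Multiplication by ω⁻¹: the side starting at the corner u has direction ζu - u = ωu.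
  backwards : Point → Point
  backwards (s , t) = t ℤ.- s , ℤ.- s
  recover : ∀ c u → backwards ((c ⊕ ζ* u) ⊖ (c ⊕ u)) ≡ u
  recover (x , y) (a , b) = cong₂ _,_ (eq₁ x y a b) (eq₂ x a b)
    where
    eq₁ : ∀ x y a b →
      ((y ℤ.+ a) ℤ.- (y ℤ.+ b)) ℤ.- ((x ℤ.+ (a ℤ.- b)) ℤ.- (x ℤ.+ a)) ≡ a
    eq₁ = solve-∀
    eq₂ : ∀ x a b → ℤ.- ((x ℤ.+ (a ℤ.- b)) ℤ.- (x ℤ.+ a)) ≡ b
    eq₂ = solve-∀
  same : corner k ≡ corner l
  same = trans (sym (recover (centre v) (corner k)))
    (trans (cong₂ (λ s t → backwards (s ⊖ t)) q p) (recover (centre w) (corner l)))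

⊕-comm : ∀ p q → p ⊕ q ≡ q ⊕ p
⊕-comm (a , b) (c , d) = cong₂ _,_ (ℤ.+-comm a c) (ℤ.+-comm b d)

-- A left inverse of `corner` on the exponents below 6. The last clause is a default that no corner
-- reaches.
index : Point → ℕ
index (+ 1 , + 0)              = 0
index (+ 1 , + 1)              = 1
index (+ 0 , + 1)              = 2
index (-[1+ 0 ] , + 0)         = 3
index (-[1+ 0 ] , -[1+ 0 ])    = 4
index (+ 0 , -[1+ 0 ])         = 5
index _                        = 0

divide : ∀ k → k ≡ k ℕ./ 6 ℕ.* 6 ℕ.+ k ℕ.% 6
divide k = trans (ℕ.m≡m%n+[m/n]*n k 6) (ℕ.+-comm (k ℕ.% 6) (k ℕ./ 6 ℕ.* 6))

corner-%6 : ∀ k → corner k ≡ corner (k ℕ.% 6)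
corner-%6 k = trans (cong corner (divide k)) (corner-*6 (k ℕ./ 6) (k ℕ.% 6))

index-corner : ∀ k → k ℕ.< 6 → index (corner k) ≡ k
index-corner 0 _ = refl
index-corner 1 _ = refl
index-corner 2 _ = refl
index-corner 3 _ = refl
index-corner 4 _ = refl
index-corner 5 _ = refl
index-corner (suc (suc (suc (suc (suc (suc k)))))) (ℕ.s≤s (ℕ.s≤s (ℕ.s≤s (ℕ.s≤s (ℕ.s≤s (ℕ.s≤s ()))))))

corner-injective : ∀ k l → corner k ≡ corner l → k ℕ.% 6 ≡ l ℕ.% 6
corner-injective k l eq = begin
  k ℕ.% 6                       ≡⟨ index-corner (k ℕ.% 6) (ℕ.m%n<n k 6) ⟨
  index (corner (k ℕ.% 6))      ≡⟨ cong index (trans (sym (corner-%6 k)) (trans eq (corner-%6 l))) ⟩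
  index (corner (l ℕ.% 6))      ≡⟨ index-corner (l ℕ.% 6) (ℕ.m%n<n l 6) ⟩
  l ℕ.% 6                       ∎

-- Coverings of a trihex by the tiling

-- `s`, `f` and `a` stand for σ, φ and α on numbered darts, and `o` for a dart on the boundary of a
-- triangle.
module Covering {n : ℕ} (s f a : Fin n → Fin n)
  (s∘f≗a : ∀ d → s (f d) ≡ a d)
  (s³≗id : ∀ d → s (s (s d)) ≡ d)
  (f⁶≗id : ∀ d → fold d f 6 ≡ d)
  (a²≗id : ∀ d → a (a d) ≡ d)
  (f-free : ∀ d → f d ≢ d)
  (a-free : ∀ d → a d ≢ d)
  (o : Fin n) (f³o≡o : fold o f 3 ≡ o)
  where

  s≗af⁵ : ∀ d → s d ≡ a (fold d f 5)
  s≗af⁵ d = trans (cong s (sym (f⁶≗id d))) (s∘f≗a (fold d f 5))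

  -- Since s⁻¹ = f a, the relation s³ = 1 reads (f a)³ = 1, that is, f a f = a f⁻¹ a; the inverse of
  -- `f` is written f⁵.
  faf≗af⁵a : ∀ d → f (a (f d)) ≡ a (fold (a d) f 5)
  faf≗af⁵a d = begin
    f (a (f d))                ≡⟨ s³≗id _ ⟨
    s (s (s (f (a (f d)))))    ≡⟨ cong (λ e → s (s e)) (trans (s∘f≗a _) (a²≗id _)) ⟩
    s (s (f d))                ≡⟨ cong s (s∘f≗a d) ⟩
    s (a d)                    ≡⟨ s≗af⁵ (a d) ⟩
    a (fold (a d) f 5)         ∎

  -- X and Y correspond to the translations by 2 + ω and 1 + 2ω.
  X Y : Fin n ↔ Fin n
  X = mk↔ₛ′ (λ d → f (f (f (a d)))) (λ d → a (f (f (f d))))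
    (λ d → trans (cong (λ e → fold e f 3) (a²≗id _)) (f⁶≗id d))
    (λ d → trans (cong a (f⁶≗id (a d))) (a²≗id d))
  Y = mk↔ₛ′ (λ d → f (f (a (f d)))) (λ d → fold (a (fold d f 4)) f 5)
    (λ d → trans (cong (λ e → f (f (a e))) (f⁶≗id _))
      (trans (cong (λ e → f (f e)) (a²≗id _)) (f⁶≗id d)))
    (λ d → trans (cong (λ e → fold (a e) f 5) (f⁶≗id _))
      (trans (cong (λ e → fold e f 5) (a²≗id _)) (f⁶≗id d)))

  -- After cancelling f² on the left, two uses of `faf≗af⁵a` turn (f a f)(f a f) into a f⁻² a = a f⁴
  -- a.
  X∘Y≗Y∘X : ∀ d → Inverse.to X (Inverse.to Y d) ≡ Inverse.to Y (Inverse.to X d)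
  X∘Y≗Y∘X d = cong (λ e → f (f e)) (begin
    f (a (f (f (a (f d)))))                       ≡⟨ faf≗af⁵a (f (a (f d))) ⟩
    a (fold (a (f (a (f d)))) f 5)                ≡⟨ cong (λ e → a (fold (a e) f 5)) (faf≗af⁵a d) ⟩
    a (fold (a (a (fold (a d) f 5))) f 5)         ≡⟨ cong (λ e → a (fold e f 5)) (a²≗id _) ⟩
    a (fold (fold (a d) f 5) f 5)                 ≡⟨ cong (λ e → a (fold e f 4)) (f⁶≗id (a d)) ⟩
    a (f (f (f (f (a d)))))                       ∎)

  shift : Point → Fin n → Fin n
  shift (x , y) d = pow X x (pow Y y d)

  shift-⊕ : ∀ v w d → shift (v ⊕ w) d ≡ shift v (shift w d)
  shift-⊕ (x , y) (x′ , y′) d = begin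
    pow X (x ℤ.+ x′) (pow Y (y ℤ.+ y′) d)         ≡⟨ cong (pow X (x ℤ.+ x′)) (pow-+ Y y y′ d) ⟩
    pow X (x ℤ.+ x′) (pow Y y (pow Y y′ d))       ≡⟨ pow-+ X x x′ _ ⟩
    pow X x (pow X x′ (pow Y y (pow Y y′ d)))
      ≡⟨ cong (pow X x) (pow-commute X Y X∘Y≗Y∘X x′ y _) ⟩
    pow X x (pow Y y (pow X x′ (pow Y y′ d)))     ∎

  shift-line : ∀ v → IsAction (λ t → shift (t · v))
  shift-line v@(x , y) = record
    { identity = λ _ → refl
    ; compose  = λ s t d → trans
        (cong (λ w → shift w d) (cong₂ _,_ (ℤ.*-distribʳ-+ x s t) (ℤ.*-distribʳ-+ y s t)))
        (shift-⊕ (s · v) (t · v) d)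
    }

  shift-opposite : ∀ v d → shift (opposite v) (shift v d) ≡ d
  shift-opposite v@(x , y) d = trans (sym (shift-⊕ (opposite v) v d))
    (cong (λ w → shift w d) (cong₂ _,_ (ℤ.+-inverseˡ x) (ℤ.+-inverseˡ y)))

  -- Multiplication by ζ⁻¹ in the basis 2 + ω, 1 + 2ω.
  ζ⁻¹* : Point → Point
  ζ⁻¹* (x , y) = x ℤ.+ y , ℤ.- x

  -- Conjugation by `f` turns the translations by -60°. Only generators need checking: f Y = X f
  -- holds by definition, and f X = X Y⁻¹ f follows from `faf≗af⁵a`.
  f-shift : ∀ v d → f (shift v d) ≡ shift (ζ⁻¹* v) (f d)
  f-shift (x , y) d = begin
    f (pow X x (pow Y y d))
      ≡⟨ pow-intertwines X (shift-line (+ 1 , -[1+ 0 ])) {f} f-X x _ ⟩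
    shift (x · (+ 1 , -[1+ 0 ])) (f (pow Y y d))
      ≡⟨ cong (shift (x · (+ 1 , -[1+ 0 ]))) (pow-intertwines Y (pow-isAction X) {f} (λ _ → refl) y d) ⟩
    shift (x · (+ 1 , -[1+ 0 ])) (shift (y , + 0) (f d))
      ≡⟨ shift-⊕ (x · (+ 1 , -[1+ 0 ])) (y , + 0) (f d) ⟨
    shift (x · (+ 1 , -[1+ 0 ]) ⊕ (y , + 0)) (f d)
      ≡⟨ cong (λ w → shift w (f d)) (cong₂ _,_ (eq₁ x y) (eq₂ x)) ⟩
    shift (x ℤ.+ y , ℤ.- x) (f d)                        ∎
    where
    -- The right-hand side is X Y⁻¹ applied to `f d`, unfolded.
    f-X : ∀ d → f (f (f (f (a d)))) ≡ fold (a (fold (a (fold (f d) f 4)) f 5)) f 3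
    f-X d = sym (begin
      fold (a (fold (a (fold d f 5)) f 5)) f 3
        ≡⟨ cong (λ e → fold e f 3) (faf≗af⁵a (fold d f 5)) ⟨
      fold (f (a (fold d f 6))) f 3                  ≡⟨ cong (λ e → fold (a e) f 4) (f⁶≗id d) ⟩
      f (f (f (f (a d))))                            ∎)
    eq₁ : ∀ x y → x ℤ.* + 1 ℤ.+ y ≡ x ℤ.+ y
    eq₁ = solve-∀
    eq₂ : ∀ x → x ℤ.* -[1+ 0 ] ℤ.+ + 0 ≡ ℤ.- x
    eq₂ = solve-∀

  f³-shift : ∀ v d → fold (shift v d) f 3 ≡ shift (opposite v) (fold d f 3)
  f³-shift v@(x , y) d = begin
    f (f (f (shift v d)))                 ≡⟨ cong (λ e → f (f e)) (f-shift v d) ⟩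
    f (f (shift (ζ⁻¹* v) (f d)))          ≡⟨ cong f (f-shift (ζ⁻¹* v) (f d)) ⟩
    f (shift (ζ⁻¹* (ζ⁻¹* v)) (f (f d)))   ≡⟨ f-shift (ζ⁻¹* (ζ⁻¹* v)) (f (f d)) ⟩
    shift (ζ⁻¹* (ζ⁻¹* (ζ⁻¹* v))) (fold d f 3)
      ≡⟨ cong (λ w → shift w (fold d f 3)) (cong₂ _,_ (eq₁ x y) (eq₂ x y)) ⟩
    shift (opposite v) (fold d f 3)       ∎
    where
    eq₁ : ∀ x y → ((x ℤ.+ y) ℤ.+ (ℤ.- x)) ℤ.+ (ℤ.- (x ℤ.+ y)) ≡ ℤ.- x
    eq₁ = solve-∀
    eq₂ : ∀ x y → ℤ.- ((x ℤ.+ y) ℤ.+ (ℤ.- x)) ≡ ℤ.- y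
    eq₂ = solve-∀

  -- Here the triangle enters: because f³ fixes `o`, the half-turn around the hexagon at the origin
  -- preserves the covering.
  f³-shift-o : ∀ v → fold (shift v o) f 3 ≡ shift (opposite v) o
  f³-shift-o v = trans (f³-shift v o) (cong (shift (opposite v)) f³o≡o)

  -- Side `k` reversed is side `k` + 3 of the neighbour across it. For `k` = 0 this is the
  -- definition of `X` together with f⁶ = 1; `f-shift` carries it from each side to the next.
  a-fold : ∀ k d → a (fold d f k) ≡ fold (shift (across k) d) f (3 ℕ.+ k)
  a-fold zero    d = sym (f⁶≗id (a d))
  a-fold (suc k) d = let b , c = corner k in begin
    a (f (fold d f k))                           ≡⟨ cong a (fold-suc f d k) ⟨
    a (fold (f d) f k)                           ≡⟨ a-fold k (f d) ⟩
    fold (shift (across k) (f d)) f (3 ℕ.+ k)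
      ≡⟨ cong (λ w → fold (shift w (f d)) f (3 ℕ.+ k)) (cong₂ _,_ (eq₁ b c) (eq₂ b c)) ⟩
    fold (shift (ζ⁻¹* (across (suc k))) (f d)) f (3 ℕ.+ k)
      ≡⟨ cong (λ e → fold e f (3 ℕ.+ k)) (f-shift (across (suc k)) d) ⟨
    fold (f (shift (across (suc k)) d)) f (3 ℕ.+ k)
      ≡⟨ fold-suc f (shift (across (suc k)) d) (3 ℕ.+ k) ⟩
    fold (shift (across (suc k)) d) f (4 ℕ.+ k)  ∎
    where
    eq₁ : ∀ b c → b ℤ.- c ≡ ((b ℤ.- c) ℤ.- b) ℤ.+ b
    eq₁ = solve-∀
    eq₂ : ∀ b c → c ≡ ℤ.- ((b ℤ.- c) ℤ.- b)
    eq₂ = solve-∀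

  fold-*6 : ∀ m d → fold d f (m ℕ.* 6) ≡ d
  fold-*6 zero    d = refl
  fold-*6 (suc m) d = trans (f⁶≗id _) (fold-*6 m d)

  -- develop v k is the image of side k of the hexagon with centre v under the
  -- covering of the trihex by the tiling that takes side 0 at the origin to o.
  develop : Point → ℕ → Fin n
  develop v k = fold (shift v o) f k

  develop-%6 : ∀ v k → develop v k ≡ develop v (k ℕ.% 6)
  develop-%6 v k = begin
    develop v k                                  ≡⟨ cong (develop v) (divide k) ⟩
    develop v (k ℕ./ 6 ℕ.* 6 ℕ.+ k ℕ.% 6)        ≡⟨ fold-+ (shift v o) f (k ℕ./ 6 ℕ.* 6) ⟩
    fold (develop v (k ℕ.% 6)) f (k ℕ./ 6 ℕ.* 6) ≡⟨ fold-*6 (k ℕ./ 6) (develop v (k ℕ.% 6)) ⟩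
    develop v (k ℕ.% 6)                          ∎

  -- The ends of a side, in order, determine the hexagon on its left, and determine the index of the
  -- side modulo 6, which is all that `develop` depends on.
  develop-unique : ∀ v w k l → centre v ⊕ corner k ≡ centre w ⊕ corner l →
    centre v ⊕ corner (suc k) ≡ centre w ⊕ corner (suc l) → develop v k ≡ develop w l
  develop-unique v w k l p q = begin
    develop v k          ≡⟨ develop-%6 v k ⟩
    develop v (k ℕ.% 6)  ≡⟨ cong₂ develop (proj₁ vu) (corner-injective k l (proj₂ vu)) ⟩
    develop w (l ℕ.% 6)  ≡⟨ develop-%6 w l ⟨
    develop w l          ∎
    where
    vu : v ≡ w × corner k ≡ corner l
    vu = side-unique v w k l p q

  -- Symmetries that the covering cannot have

  -- A fixed point of f would be produced at the centre of any rotation by 60°.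
  no-sixfold : ∀ v w → f (shift v o) ≢ shift w o
  no-sixfold v w eq = f-free (shift r o) (begin
    f (shift r o)                                ≡⟨ f-shift r o ⟩
    shift (ζ⁻¹* r) (f o)                         ≡⟨ cong (shift (ζ⁻¹* r)) f-o ⟩
    shift (ζ⁻¹* r) (shift t o)                   ≡⟨ shift-⊕ (ζ⁻¹* r) t o ⟨
    shift (ζ⁻¹* r ⊕ t) o
      ≡⟨ cong (λ w → shift w o) (cong₂ _,_ (eq₁ (proj₁ t) (proj₂ t)) (eq₂ (proj₁ t) (proj₂ t))) ⟩
    shift r o                                    ∎)
    where
    -- `f o` equals `shift t o`, and `r` must solve r = ζ⁻¹r + t. As 1 - ζ⁻¹ = ζ, the solution is r
    -- = ζ⁻¹t.
    t r : Point
    t = opposite (ζ⁻¹* v) ⊕ w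
    r = proj₁ t ℤ.+ proj₂ t , ℤ.- proj₁ t
    f-o : f o ≡ shift t o
    f-o = begin
      f o                                                  ≡⟨ shift-opposite (ζ⁻¹* v) (f o) ⟨
      shift (opposite (ζ⁻¹* v)) (shift (ζ⁻¹* v) (f o))
        ≡⟨ cong (shift (opposite (ζ⁻¹* v))) (f-shift v o) ⟨
      shift (opposite (ζ⁻¹* v)) (f (shift v o))            ≡⟨ cong (shift (opposite (ζ⁻¹* v))) eq ⟩
      shift (opposite (ζ⁻¹* v)) (shift w o)                ≡⟨ shift-⊕ (opposite (ζ⁻¹* v)) w o ⟨
      shift t o                                            ∎
    eq₁ : ∀ x y → ((x ℤ.+ y) ℤ.+ (ℤ.- x)) ℤ.+ x ≡ x ℤ.+ y
    eq₁ = solve-∀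
    eq₂ : ∀ x y → ℤ.- (x ℤ.+ y) ℤ.+ y ≡ ℤ.- x
    eq₂ = solve-∀

  -- Composed with the half-turn at the origin, a rotation by 120° becomes one by -60°.
  no-threefold : ∀ v w → f (f (shift v o)) ≢ shift w o
  no-threefold v w eq = no-sixfold w (opposite v) (trans (cong f (sym eq)) (f³-shift-o v))

  -- Composed with the half-turn at the origin, such a translation would give the half-turn around
  -- the midpoint of side `k` of the hexagon `v`. That side would map to a dart fixed by `a`.
  no-edge-centre : ∀ k v → shift (across k ⊕ (v ⊕ v)) o ≢ o
  no-edge-centre k v eq = a-free (fold e f k) (begin
    a (fold e f k)                             ≡⟨ a-fold k e ⟩
    fold (shift (across k) e) f (3 ℕ.+ k)      ≡⟨ cong (λ d → fold d f (3 ℕ.+ k)) folded ⟩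
    fold (fold e f 3) f (3 ℕ.+ k)              ≡⟨ fold-+ e f (3 ℕ.+ k) ⟨
    fold e f (3 ℕ.+ k ℕ.+ 3)                   ≡⟨ cong (fold e f) (ℕ.+-comm (3 ℕ.+ k) 3) ⟩
    fold e f (6 ℕ.+ k)                         ≡⟨ f⁶≗id _ ⟩
    fold e f k                                 ∎)
    where
    e : Fin n
    e = shift v o
    rearrange : ∀ u v → opposite v ⊕ (u ⊕ (v ⊕ v)) ≡ u ⊕ v
    rearrange (x , y) (x′ , y′) = cong₂ _,_ (eq₁ x x′) (eq₁ y y′)
      where
      eq₁ : ∀ u v → ℤ.- v ℤ.+ (u ℤ.+ (v ℤ.+ v)) ≡ u ℤ.+ v
      eq₁ = solve-∀
    folded : shift (across k) e ≡ fold e f 3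
    folded = begin
      shift (across k) (shift v o)                         ≡⟨ shift-⊕ (across k) v o ⟨
      shift (across k ⊕ v) o
        ≡⟨ cong (λ w → shift w o) (rearrange (across k) v) ⟨
      shift (opposite v ⊕ (across k ⊕ (v ⊕ v))) o          ≡⟨ shift-⊕ (opposite v) _ o ⟩
      shift (opposite v) (shift (across k ⊕ (v ⊕ v)) o)    ≡⟨ cong (shift (opposite v)) eq ⟩
      shift (opposite v) o                                 ≡⟨ f³-shift-o v ⟨
      fold e f 3                                           ∎

  -- The three nonzero classes modulo 2 are represented by `across 0`, `across 1` and `across 2`,
  -- and `no-edge-centre` excludes each of them.
  stabilizer-even : ∀ v → shift v o ≡ o → ∃[ w ] v ≡ w ⊕ w
  stabilizer-even (x , y) eq with parity x | parity y
  ... | inj₁ (s , refl) | inj₁ (t , refl) = (s , t) , refl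
  ... | inj₂ (s , refl) | inj₁ (t , refl) = contradiction
    (trans (cong (λ z → shift (+ 1 ℤ.+ (s ℤ.+ s) , z) o) (ℤ.+-identityˡ (t ℤ.+ t))) eq)
    (no-edge-centre 0 (s , t))
  ... | inj₁ (s , refl) | inj₂ (t , refl) = contradiction
    (trans (cong (λ z → shift (z , + 1 ℤ.+ (t ℤ.+ t)) o) (ℤ.+-identityˡ (s ℤ.+ s))) eq)
    (no-edge-centre 1 (s , t))
  -- `across 2` is (-1 , 1), so its first coordinate has to be compensated by replacing `s` with `s`
  -- + 1.
  ... | inj₂ (s , refl) | inj₂ (t , refl) = contradiction
    (trans (cong (λ z → shift (z , + 1 ℤ.+ (t ℤ.+ t)) o) (step s)) eq)
    (no-edge-centre 2 (s ℤ.+ + 1 , t))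
    where
    step : ∀ s → -[1+ 0 ] ℤ.+ ((s ℤ.+ + 1) ℤ.+ (s ℤ.+ + 1)) ≡ + 1 ℤ.+ (s ℤ.+ s)
    step = solve-∀

  -- By the pigeonhole principle two of the n + 1 multiples of `v` from 0 to n move `o` to the same
  -- dart; their difference fixes it.
  period : ∀ v → ∃[ k ] shift (+ suc k · v) o ≡ o
  period v with Fin.pigeonhole (ℕ.n<1+n n) (λ i → shift (+ toℕ i · v) o)
  ... | i , j , i<j , eq with ℕ.m≤n⇒∃[o]m+o≡n i<j
  ... | k , i+k≡j = k , (begin
    shift (+ suc k · v) o
      ≡⟨ shift-opposite (+ toℕ i · v) _ ⟨
    shift (opposite (+ toℕ i · v)) (shift (+ toℕ i · v) (shift (+ suc k · v) o))
      ≡⟨ cong (shift (opposite (+ toℕ i · v))) (IsAction.compose (shift-line v) (+ toℕ i) (+ suc k) o) ⟨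
    shift (opposite (+ toℕ i · v)) (shift (+ (toℕ i ℕ.+ suc k) · v) o)
      ≡⟨ cong (λ t → shift (opposite (+ toℕ i · v)) (shift (+ t · v) o)) (trans (ℕ.+-suc (toℕ i) k) i+k≡j) ⟩
    shift (opposite (+ toℕ i · v)) (shift (+ toℕ j · v) o)
      ≡⟨ cong (shift (opposite (+ toℕ i · v))) eq ⟨
    shift (opposite (+ toℕ i · v)) (shift (+ toℕ i · v) o)
      ≡⟨ shift-opposite (+ toℕ i · v) o ⟩
    o ∎)

  -- The lattice of half-turn centres and its Hermite normal form

  -- The half-turn around centre v is a symmetry of the covering.
  record Λ (v : Point) : Set where
    constructor fixes
    field fixed : shift (v ⊕ v) o ≡ o

  Λ-⊕ : ∀ {v w} → Λ v → Λ w → Λ (v ⊕ w)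
  Λ-⊕ {v@(x , y)} {w@(x′ , y′)} (fixes Λv) (fixes Λw) = fixes (begin
    shift ((v ⊕ w) ⊕ (v ⊕ w)) o      ≡⟨ cong (λ u → shift u o) (cong₂ _,_ (eq x x′) (eq y y′)) ⟩
    shift ((v ⊕ v) ⊕ (w ⊕ w)) o      ≡⟨ shift-⊕ (v ⊕ v) (w ⊕ w) o ⟩
    shift (v ⊕ v) (shift (w ⊕ w) o)  ≡⟨ cong (shift (v ⊕ v)) Λw ⟩
    shift (v ⊕ v) o                  ≡⟨ Λv ⟩
    o                                ∎)
    where
    eq : ∀ x y → (x ℤ.+ y) ℤ.+ (x ℤ.+ y) ≡ (x ℤ.+ x) ℤ.+ (y ℤ.+ y)
    eq = solve-∀

  Λ-opposite : ∀ {v} → Λ v → Λ (opposite v)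
  Λ-opposite {v@(x , y)} (fixes Λv) = fixes (begin
    shift (opposite v ⊕ opposite v) o
      ≡⟨ cong (λ u → shift u o) (cong₂ _,_ (ℤ.neg-distrib-+ x x) (ℤ.neg-distrib-+ y y)) ⟨
    shift (opposite (v ⊕ v)) o                     ≡⟨ cong (shift (opposite (v ⊕ v))) Λv ⟨
    shift (opposite (v ⊕ v)) (shift (v ⊕ v) o)     ≡⟨ shift-opposite (v ⊕ v) o ⟩
    o                                              ∎)

  Λ-⊖ : ∀ {v w} → Λ v → Λ w → Λ (v ⊖ w)
  Λ-⊖ Λv Λw = Λ-⊕ Λv (Λ-opposite Λw)

  Λ-multiples : ∀ {v} → Λ v → ∀ j → Λ (j · v)
  Λ-multiples {v@(x , y)} Λv j = subst (λ t → Λ (t · v)) (ℤ.*-identityʳ j)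
    (multiples {P = λ t → Λ (t · v)} closed (+ 1)
      (subst Λ (cong₂ _,_ (sym (ℤ.*-identityˡ x)) (sym (ℤ.*-identityˡ y))) Λv) j)
    where
    eq : ∀ s t x → s ℤ.* x ℤ.- t ℤ.* x ≡ (s ℤ.- t) ℤ.* x
    eq = solve-∀
    closed : Closed (λ t → Λ (t · v))
    closed s t Λs Λt = subst Λ (cong₂ _,_ (eq s t x) (eq s t y)) (Λ-⊖ Λs Λt)

  Λ-period : ∀ v → ∃[ k ] Λ (+ suc k · v)
  Λ-period v with period v
  ... | k , eq = k , fixes (begin
    shift (+ suc k · v ⊕ + suc k · v) o          ≡⟨ shift-⊕ (+ suc k · v) (+ suc k · v) o ⟩
    shift (+ suc k · v) (shift (+ suc k · v) o)  ≡⟨ cong (shift (+ suc k · v)) eq ⟩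
    shift (+ suc k · v) o                        ≡⟨ eq ⟩
    o                                            ∎)

  Λ? : Decidable Λ
  Λ? v = map′ fixes Λ.fixed (shift (v ⊕ v) o Fin.≟ o)

  -- The vertical vectors of the lattice, (0 , 1) being the coordinates of 1 + 2ω. Together with the
  -- projection `Abscissa` they yield a triangular basis.
  Ordinate : ℤ → Set
  Ordinate y = Λ (+ 0 , y)

  Ordinate-closed : Closed Ordinate
  Ordinate-closed _ _ = Λ-⊖

  Abscissa : ℤ → Set
  Abscissa x = ∃[ y ] Λ (x , y)

  Abscissa-closed : Closed Abscissa
  Abscissa-closed _ _ (y , Λv) (y′ , Λw) = y ℤ.- y′ , Λ-⊖ Λv Λw

  -- Subtracting multiples of (0 , `suc q`) reduces the unknown ordinate modulo `suc q`, which makes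
  -- the search finite.
  Abscissa? : ∀ q → Ordinate (+ suc q) → Decidable Abscissa
  Abscissa? q Λq x = map′ (λ (r , Λr) → + toℕ r , Λr) reduce
    (Fin.any? {n = suc q} (λ r → Λ? (x , + toℕ r)))
    where
    reduce : Abscissa x → ∃[ r ] Λ (x , + toℕ {suc q} r)
    reduce (y , Λv) = fromℕ< (ℤ.n%ℕd<d y (suc q)) ,
      subst Λ (cong₂ _,_ (first x (y ℤ./ℕ suc q)) second)
        (Λ-⊖ Λv (Λ-multiples Λq (y ℤ./ℕ suc q)))
      where
      first : ∀ x t → x ℤ.- t ℤ.* + 0 ≡ x
      first = solve-∀
      cancel : ∀ r t → (r ℤ.+ t) ℤ.- t ≡ r
      cancel = solve-∀
      second : y ℤ.- (y ℤ./ℕ suc q) ℤ.* + suc q ≡ + toℕ (fromℕ< (ℤ.n%ℕd<d y (suc q)))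
      second = begin
        y ℤ.- (y ℤ./ℕ suc q) ℤ.* + suc q
          ≡⟨ cong (ℤ._- (y ℤ./ℕ suc q) ℤ.* + suc q) (ℤ.a≡a%ℕn+[a/ℕn]*n y (suc q)) ⟩
        (+ (y ℤ.%ℕ suc q) ℤ.+ (y ℤ./ℕ suc q) ℤ.* + suc q) ℤ.- (y ℤ./ℕ suc q) ℤ.* + suc q
          ≡⟨ cancel (+ (y ℤ.%ℕ suc q)) ((y ℤ./ℕ suc q) ℤ.* + suc q) ⟩
        + (y ℤ.%ℕ suc q)
          ≡⟨ cong +_ (Fin.toℕ-fromℕ< (ℤ.n%ℕd<d y (suc q))) ⟨
        + toℕ (fromℕ< (ℤ.n%ℕd<d y (suc q))) ∎

  ordinates : Generated Ordinate-closed
  ordinates = let k , Λk = Λ-period (+ 0 , + 1) in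
    generated Ordinate-closed (λ y → Λ? (+ 0 , y)) k
      (subst Λ (cong₂ _,_ (ℤ.*-zeroʳ (+ suc k)) (ℤ.*-identityʳ (+ suc k))) Λk)

  abscissas : ∀ q → Ordinate (+ suc q) → Generated Abscissa-closed
  abscissas q Λq = let k , Λk = Λ-period (+ 1 , + 0) in
    generated Abscissa-closed (Abscissa? q Λq) k
      (+ suc k ℤ.* + 0 , subst (λ x → Λ (x , + suc k ℤ.* + 0)) (ℤ.*-identityʳ (+ suc k)) Λk)

  record Basis : Set where
    field
      p q : ℕ
      r   : ℤ
    combination : ℤ × ℤ → Point
    combination (i , j) = i · (+ suc p , r) ⊕ j · (+ 0 , + suc q)
    field
      sound    : ∀ ij → Λ (combination ij)
      complete : ∀ v → Λ v → ∃[ ij ] v ≡ combination ij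

  basis : Basis
  basis with ordinates
  ... | q , Λq , vertical with abscissas q Λq
  ... | p , (r , Λpr) , horizontal = record
    { p = p ; q = q ; r = r
    ; sound    = λ (i , j) → Λ-⊕ (Λ-multiples Λpr i) (Λ-multiples Λq j)
    ; complete = λ (x , y) Λv → complete x y Λv (horizontal x (y , Λv))
    }
    where
    eq₁ : ∀ i j P → i ℤ.* P ≡ i ℤ.* P ℤ.+ j ℤ.* + 0
    eq₁ = solve-∀
    eq₂ : ∀ y z → y ≡ z ℤ.+ (y ℤ.- z)
    eq₂ = solve-∀
    complete : ∀ x y → Λ (x , y) → ∃[ i ] x ≡ i ℤ.* + suc p →
      ∃[ (i , j) ] (x , y) ≡ i · (+ suc p , r) ⊕ j · (+ 0 , + suc q)
    -- Subtracting `i` times the first basis vector leaves a vertical vector of the lattice.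
    complete x y Λv (i , refl) with vertical (y ℤ.- i ℤ.* r)
      (subst (λ z → Λ (z , y ℤ.- i ℤ.* r)) (ℤ.+-inverseʳ (i ℤ.* + suc p))
        (Λ-⊖ Λv (Λ-multiples Λpr i)))
    ... | j , eq = (i , j) , cong₂ _,_ (eq₁ i j (+ suc p))
      (trans (eq₂ y (i ℤ.* r)) (cong (λ z → i ℤ.* r ℤ.+ z) eq))

  -- The covering map on the darts of the tiling

  image : TilingDart → Fin n
  image (dart _ _ (_ , k , (x , y , _) , _)) = develop (x , y) k

  image-unique : ∀ t v k → TilingDart.source t ≡ centre v ⊕ corner k →
    TilingDart.target t ≡ centre v ⊕ corner (suc k) → image t ≡ develop v k
  image-unique (dart p q (_ , l , (x , y , c≡) , p≡ , q≡)) v k p≡′ q≡′ =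
    develop-unique (x , y) v l k
      (trans (cong (_⊕ corner l) (sym c≡)) (trans (sym p≡) p≡′))
      (trans (cong (_⊕ corner (suc l)) (sym c≡)) (trans (sym q≡) q≡′))

  -- A hexagon has p and q as consecutive corners, and its side from p to q maps to d.
  Sits : Point → Point → Fin n → Set
  Sits p q d = ∃[ v ] ∃[ k ] p ≡ centre v ⊕ corner k × q ≡ centre v ⊕ corner (suc k) × d ≡ develop v k

  sits : ∀ t → Sits (TilingDart.source t) (TilingDart.target t) (image t)
  sits (dart _ _ (_ , k , (x , y , c≡) , p≡ , q≡)) = (x , y) , k
    , trans p≡ (cong (_⊕ corner k) c≡)
    , trans q≡ (cong (_⊕ corner (suc k)) c≡)
    , refl

  -- Any description of a side computes its image, not only the one stored in the dart, so equations
  -- for `image` can be proved from whichever hexagon is convenient.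
  image-sits : ∀ t {d} → Sits (TilingDart.source t) (TilingDart.target t) d → image t ≡ d
  image-sits t (v , k , p≡ , q≡ , d≡) = trans (image-unique t v k p≡ q≡) (sym d≡)

  -- The reversed side lies on the boundary of the neighbour across side `k`, where its index is `k`
  -- + 3; `a-fold` says that the covering agrees.
  flip-sits : ∀ {p q d} → Sits p q d → Sits q p (a d)
  flip-sits (v , k , refl , refl , refl) = v ⊕ across k , 3 ℕ.+ k
    , from-neighbour (corner (suc k)) (corner k) (3 ℕ.+ k) (⊕-comm (corner k) (corner (suc k))) (corner-3 k)
    , from-neighbour (corner k) (corner (suc k)) (4 ℕ.+ k) refl (corner-3 (suc k))
    , trans (a-fold k (shift v o)) (cong (λ d → fold d f (3 ℕ.+ k))
        (trans (sym (shift-⊕ (across k) v o)) (cong (λ w → shift w o) (⊕-comm (across k) v))))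
    where
    from-neighbour : ∀ u u′ l → corner k ⊕ corner (suc k) ≡ u ⊕ u′ → corner l ≡ opposite u′ →
      centre v ⊕ u ≡ centre (v ⊕ across k) ⊕ corner l
    from-neighbour u u′ l eq₁ eq₂ = sym (begin
      centre (v ⊕ across k) ⊕ corner l
        ≡⟨ cong₂ _⊕_ (centre-⊕ v (across k)) eq₂ ⟩
      (centre v ⊕ centre (across k)) ⊕ opposite u′
        ≡⟨ cong (λ z → (centre v ⊕ z) ⊕ opposite u′) (trans (centre-across k) eq₁) ⟩
      (centre v ⊕ (u ⊕ u′)) ⊕ opposite u′                       ≡⟨ ring (centre v) u u′ ⟩
      centre v ⊕ u                                              ∎)
      where
      ring : ∀ c u u′ → (c ⊕ (u ⊕ u′)) ⊕ opposite u′ ≡ c ⊕ u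
      ring (x , y) (x₁ , y₁) (x₂ , y₂) = cong₂ _,_ (eq x x₁ x₂) (eq y y₁ y₂)
        where
        eq : ∀ c u u′ → (c ℤ.+ (u ℤ.+ u′)) ℤ.- u′ ≡ c ℤ.+ u
        eq = solve-∀

  image-flip : ∀ t → image (flipDart t) ≡ a (image t)
  image-flip t = image-sits (flipDart t) (flip-sits (sits t))

  -- Since s = a f⁻¹, one goes back to the preceding side of the hexagon, with index 5 + `k`, which
  -- ends at `p`, and reverses it.
  turn-sits : ∀ {p q d} → Sits p q d → Sits p (turn p q) (s d)
  turn-sits {d = d} (v , k , refl , refl , refl) = subst (Sits _ _) (sym (s≗af⁵ d))
    (flip-sits (v , 5 ℕ.+ k
      , trans (turn-corner (centre v) (corner k)) (cong (centre v ⊕_) (sym (corner-3 (2 ℕ.+ k))))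
      , cong (centre v ⊕_) (sym (corner-6 k))
      , refl))
    where
    turn-corner : ∀ c u → turn (c ⊕ u) (c ⊕ ζ* u) ≡ c ⊕ opposite (ζ* (ζ* u))
    turn-corner (x , y) (a , b) = cong₂ _,_ (eq₁ x y a b) (eq₂ x y a b)
      where
      eq₁ : ∀ x y a b → (x ℤ.+ a) ℤ.+ (ℤ.- ((y ℤ.+ a) ℤ.- (y ℤ.+ b))) ≡ x ℤ.+ (ℤ.- ((a ℤ.- b) ℤ.- a))
      eq₁ = solve-∀
      eq₂ : ∀ x y a b → (y ℤ.+ b)
        ℤ.+ (((x ℤ.+ (a ℤ.- b)) ℤ.- (x ℤ.+ a)) ℤ.- ((y ℤ.+ a) ℤ.- (y ℤ.+ b))) ≡ y ℤ.+ (ℤ.- (a ℤ.- b))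
      eq₂ = solve-∀

  image-turn : ∀ t → image (turnDart t) ≡ s (image t)
  image-turn t = image-sits (turnDart t) (turn-sits (sits t))

  -- The grid and the fibres of the covering

  module Quotient (B : Basis) where
    open Basis B

    grid : ParallelogramGrid
    grid = record
      { origin        = + 0 , + 0
      ; u             = centre (+ suc p , r)
      ; w             = centre (+ 0 , + suc q)
      ; nondegenerate = λ eq → nonzero (trans (sym (det≡ (+ suc p) (+ suc q) r)) eq)
      ; w-vertical    = vertical (+ suc q)
      ; centred       = λ ij → proj₁ (combination ij) , proj₂ (combination ij) , vertex≡ ij
      }
      where
      -- The factor 3 is the determinant of 2 + ω and 1 + 2ω.
      det≡ : ∀ P Q r → (P ℤ.* + 2 ℤ.+ r ℤ.* + 1) ℤ.* (+ 0 ℤ.* + 1 ℤ.+ Q ℤ.* + 2)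
                   ℤ.- (P ℤ.* + 1 ℤ.+ r ℤ.* + 2) ℤ.* (+ 0 ℤ.* + 2 ℤ.+ Q ℤ.* + 1)
           ≡ P ℤ.* Q ℤ.* + 3
      det≡ = solve-∀
      nonzero : + suc p ℤ.* + suc q ℤ.* + 3 ≢ + 0
      nonzero ()
      vertical : ∀ Q → + 2 ℤ.* (+ 0 ℤ.* + 2 ℤ.+ Q ℤ.* + 1) ≡ + 0 ℤ.* + 1 ℤ.+ Q ℤ.* + 2
      vertical = solve-∀
      vertex≡ : ∀ ij → (+ 0 , + 0) ⊕ (proj₁ ij · centre (+ suc p , r) ⊕ proj₂ ij · centre (+ 0 , + suc q))
              ≡ centre (combination ij)
      vertex≡ (i , j) = cong₂ _,_ (eq₁ i j (+ suc p) (+ suc q) r) (eq₂ i j (+ suc p) (+ suc q) r)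
        where
        eq₁ : ∀ i j P Q r → + 0 ℤ.+ (i ℤ.* (P ℤ.* + 2 ℤ.+ r ℤ.* + 1) ℤ.+ j ℤ.* (+ 0 ℤ.* + 2 ℤ.+ Q ℤ.* + 1))
            ≡ (i ℤ.* P ℤ.+ j ℤ.* + 0) ℤ.* + 2 ℤ.+ (i ℤ.* r ℤ.+ j ℤ.* Q) ℤ.* + 1
        eq₁ = solve-∀
        eq₂ : ∀ i j P Q r → + 0 ℤ.+ (i ℤ.* (P ℤ.* + 1 ℤ.+ r ℤ.* + 2) ℤ.+ j ℤ.* (+ 0 ℤ.* + 1 ℤ.+ Q ℤ.* + 2))
            ≡ (i ℤ.* P ℤ.+ j ℤ.* + 0) ℤ.* + 1 ℤ.+ (i ℤ.* r ℤ.+ j ℤ.* Q) ℤ.* + 2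
        eq₂ = solve-∀

    open ParallelogramGrid grid using (vertex)

    vertex≡ : ∀ ij → vertex ij ≡ centre (combination ij)
    vertex≡ ij = proj₂ (proj₂ (ParallelogramGrid.centred grid ij))

    halfTurn-centre : ∀ w v u → halfTurn (centre w) (centre v ⊕ u) ≡ centre ((w ⊕ w) ⊖ v) ⊕ opposite u
    halfTurn-centre w v u = begin
      (centre w ⊕ centre w) ⊖ (centre v ⊕ u)                    ≡⟨ ring (centre w) (centre v) u ⟩
      ((centre w ⊕ centre w) ⊕ opposite (centre v)) ⊕ opposite u
        ≡⟨ cong (_⊕ opposite u) (trans (cong₂ _⊕_ (sym (centre-⊕ w w)) (sym (centre-opposite v)))
             (sym (centre-⊕ (w ⊕ w) (opposite v)))) ⟩
      centre ((w ⊕ w) ⊖ v) ⊕ opposite u                          ∎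
      where
      ring : ∀ c d u → (c ⊕ c) ⊖ (d ⊕ u) ≡ ((c ⊕ c) ⊕ opposite d) ⊕ opposite u
      ring (x , y) (x₁ , y₁) (x₂ , y₂) = cong₂ _,_ (eq x x₁ x₂) (eq y y₁ y₂)
        where
        eq : ∀ c d u → (c ℤ.+ c) ℤ.- (d ℤ.+ u) ≡ ((c ℤ.+ c) ℤ.+ (ℤ.- d)) ℤ.+ (ℤ.- u)
        eq = solve-∀

    -- The half-turn around l takes the hexagon v to 2l - v and raises side indices by 3. By
    -- `f³-shift-o` these three steps of `f` replace 2l - v by v - 2l, and the translation by 2l
    -- fixes `o`.
    halfTurn-sits : ∀ ij {p q d} → Sits p q d → Sits (halfTurn (vertex ij) p) (halfTurn (vertex ij) q) d
    halfTurn-sits ij (v , k , refl , refl , refl) = (l ⊕ l) ⊖ v , 3 ℕ.+ k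
      , turned (corner k) (corner-3 k)
      , turned (corner (suc k)) (corner-3 (suc k))
      , sym unchanged
      where
      l : Point
      l = combination ij
      turned : ∀ u {u′} → u′ ≡ opposite u →
        halfTurn (vertex ij) (centre v ⊕ u) ≡ centre ((l ⊕ l) ⊖ v) ⊕ u′
      turned u eq = trans (cong (λ c → halfTurn c (centre v ⊕ u)) (vertex≡ ij))
        (trans (halfTurn-centre l v u) (cong (centre ((l ⊕ l) ⊖ v) ⊕_) (sym eq)))
      swap : ∀ l v → opposite ((l ⊕ l) ⊖ v) ≡ v ⊕ opposite (l ⊕ l)
      swap (x , y) (x′ , y′) = cong₂ _,_ (eq x x′) (eq y y′)
        where
        eq : ∀ l v → ℤ.- ((l ℤ.+ l) ℤ.- v) ≡ v ℤ.+ (ℤ.- (l ℤ.+ l))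
        eq = solve-∀
      unchanged : develop ((l ⊕ l) ⊖ v) (3 ℕ.+ k) ≡ develop v k
      unchanged = begin
        fold (shift ((l ⊕ l) ⊖ v) o) f (3 ℕ.+ k)             ≡⟨ cong (fold _ f) (ℕ.+-comm 3 k) ⟩
        fold (shift ((l ⊕ l) ⊖ v) o) f (k ℕ.+ 3)             ≡⟨ fold-+ (shift ((l ⊕ l) ⊖ v) o) f k ⟩
        fold (fold (shift ((l ⊕ l) ⊖ v) o) f 3) f k          ≡⟨ cong (λ d → fold d f k) (begin
          fold (shift ((l ⊕ l) ⊖ v) o) f 3                     ≡⟨ f³-shift-o ((l ⊕ l) ⊖ v) ⟩
          shift (opposite ((l ⊕ l) ⊖ v)) o
            ≡⟨ cong (λ w → shift w o) (swap l v) ⟩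
          shift (v ⊕ opposite (l ⊕ l)) o                       ≡⟨ shift-⊕ v (opposite (l ⊕ l)) o ⟩
          shift v (shift (opposite (l ⊕ l)) o)
            ≡⟨ cong (λ d → shift v (shift (opposite (l ⊕ l)) d)) (Λ.fixed (sound ij)) ⟨
          shift v (shift (opposite (l ⊕ l)) (shift (l ⊕ l) o))
            ≡⟨ cong (shift v) (shift-opposite (l ⊕ l) o) ⟩
          shift v o                                            ∎) ⟩
        fold (shift v o) f k                                 ∎

    act-sits : ∀ g {p q d} → Sits p q d → Sits (act grid g p) (act grid g q) d
    act-sits []       x = x
    act-sits (ij ∷ g) x = halfTurn-sits ij (act-sits g x)

    image-cong : ∀ t t′ → SameOrbit grid t t′ → image t ≡ image t′
    image-cong t t′ (g , p≡ , q≡) = sym (image-sits t′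
      (subst (λ q → Sits (TilingDart.source t′) q (image t)) q≡
        (subst (λ p → Sits p (act grid g (TilingDart.target t)) (image t)) p≡ (act-sits g (sits t)))))

    -- Every symmetry of the covering lies in the group of the grid. The induction lowers the
    -- rotation `j` by three at a time, at the cost of a half-turn around the origin; remainders 1
    -- and 2 are impossible. For 0 the symmetry is a translation by 2l with l in the lattice: the
    -- half-turn around the origin followed by the one around l.
    fibre : ∀ j v w → fold (shift v o) f j ≡ shift w o →
      ∃[ g ] ∀ i → act grid g (centre v ⊕ corner (j ℕ.+ i)) ≡ centre w ⊕ corner i
    fibre 0 v w eq = ij ∷ (+ 0 , + 0) ∷ [] , λ i → begin
      halfTurn (vertex ij) (halfTurn (vertex (+ 0 , + 0)) (centre v ⊕ corner i))
        ≡⟨ cong₂ (λ c p → halfTurn c p) (trans (vertex≡ ij) (cong centre (sym (proj₂ found))))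
             (halfTurn-centre (+ 0 , + 0) v (corner i)) ⟩
      halfTurn (centre l) (centre ((+ 0 , + 0) ⊖ v) ⊕ opposite (corner i))
        ≡⟨ halfTurn-centre l ((+ 0 , + 0) ⊖ v) (opposite (corner i)) ⟩
      centre ((l ⊕ l) ⊖ ((+ 0 , + 0) ⊖ v)) ⊕ opposite (opposite (corner i))
        ≡⟨ cong₂ (λ w u → centre w ⊕ u) reach (cong₂ _,_ (ℤ.neg-involutive _) (ℤ.neg-involutive _)) ⟩
      centre w ⊕ corner i ∎
      where
      fixed : shift (opposite v ⊕ w) o ≡ o
      fixed = begin
        shift (opposite v ⊕ w) o           ≡⟨ shift-⊕ (opposite v) w o ⟩
        shift (opposite v) (shift w o)     ≡⟨ cong (shift (opposite v)) eq ⟨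
        shift (opposite v) (shift v o)     ≡⟨ shift-opposite v o ⟩
        o                                  ∎
      even : ∃[ l ] opposite v ⊕ w ≡ l ⊕ l
      even = stabilizer-even (opposite v ⊕ w) fixed
      l : Point
      l = proj₁ even
      found : ∃[ ij ] l ≡ combination ij
      found = complete l (fixes (trans (cong (λ w → shift w o) (sym (proj₂ even))) fixed))
      ij : ℤ × ℤ
      ij = proj₁ found
      cancel : ∀ v w → (opposite v ⊕ w) ⊖ ((+ 0 , + 0) ⊖ v) ≡ w
      cancel (x , y) (x′ , y′) = cong₂ _,_ (eq′ x x′) (eq′ y y′)
        where
        eq′ : ∀ v w → (ℤ.- v ℤ.+ w) ℤ.- (+ 0 ℤ.- v) ≡ w
        eq′ = solve-∀
      reach : (l ⊕ l) ⊖ ((+ 0 , + 0) ⊖ v) ≡ w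
      reach = trans (cong (_⊖ ((+ 0 , + 0) ⊖ v)) (sym (proj₂ even))) (cancel v w)
    fibre 1 v w eq = contradiction eq (no-sixfold v w)
    fibre 2 v w eq = contradiction eq (no-threefold v w)
    fibre (suc (suc (suc j))) v w eq = extend (fibre j v (opposite w) (begin
        fold (shift v o) f j                              ≡⟨ f⁶≗id _ ⟨
        fold (fold (shift v o) f (3 ℕ.+ j)) f 3           ≡⟨ cong (λ d → fold d f 3) eq ⟩
        fold (shift w o) f 3                              ≡⟨ f³-shift-o w ⟩
        shift (opposite w) o                              ∎))
      where
      rearrange : ∀ i → j ℕ.+ (3 ℕ.+ i) ≡ suc (suc (suc j)) ℕ.+ i
      rearrange i = trans (sym (ℕ.+-assoc j 3 i)) (cong (ℕ._+ i) (ℕ.+-comm j 3))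
      undo : ∀ w → ((+ 0 , + 0) ⊕ (+ 0 , + 0)) ⊖ opposite w ≡ w
      undo (x , y) = cong₂ _,_ (eq′ x) (eq′ y)
        where
        eq′ : ∀ x → (+ 0 ℤ.+ + 0) ℤ.- (ℤ.- x) ≡ x
        eq′ = solve-∀
      extend : ∃[ g ] (∀ i → act grid g (centre v ⊕ corner (j ℕ.+ i)) ≡ centre (opposite w) ⊕ corner i) →
        ∃[ g ] ∀ i → act grid g (centre v ⊕ corner (suc (suc (suc j)) ℕ.+ i)) ≡ centre w ⊕ corner i
      extend (g , g≡) = (+ 0 , + 0) ∷ g , λ i → begin
        halfTurn (vertex (+ 0 , + 0)) (act grid g (centre v ⊕ corner (suc (suc (suc j)) ℕ.+ i)))
          ≡⟨ cong (λ m → halfTurn (vertex (+ 0 , + 0)) (act grid g (centre v ⊕ corner m))) (rearrange i) ⟨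
        halfTurn (vertex (+ 0 , + 0)) (act grid g (centre v ⊕ corner (j ℕ.+ (3 ℕ.+ i))))
          ≡⟨ cong (halfTurn (vertex (+ 0 , + 0))) (g≡ (3 ℕ.+ i)) ⟩
        halfTurn (vertex (+ 0 , + 0)) (centre (opposite w) ⊕ corner (3 ℕ.+ i))
          ≡⟨ halfTurn-centre (+ 0 , + 0) (opposite w) (corner (3 ℕ.+ i)) ⟩
        centre (((+ 0 , + 0) ⊕ (+ 0 , + 0)) ⊖ opposite w) ⊕ opposite (corner (3 ℕ.+ i))
          ≡⟨ cong₂ (λ w u → centre w ⊕ u) (undo w) (trans (cong opposite (corner-3 i))
               (cong₂ _,_ (ℤ.neg-involutive _) (ℤ.neg-involutive _))) ⟩
        centre w ⊕ corner i ∎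

    -- As `f` applied `l * 5` times is f⁻ˡ, it brings side `l` of the second hexagon back to side 0,
    -- where `fibre` applies with `j` = `l * 5 + k`. Its cases `i` = `l` and `i` = `suc l` give the
    -- two ends.
    image-injective : ∀ t t′ → image t ≡ image t′ → SameOrbit grid t t′
    image-injective t t′ eq with sits t | sits t′
    ... | v , k , p≡ , q≡ , d≡ | w , l , p′≡ , q′≡ , d′≡ =
      proj₁ found
      , trans (cong (act grid g) (trans p≡ (cong (centre v ⊕_) (sym (turns k l)))))
          (trans (g≡ l) (sym p′≡))
      , trans (cong (act grid g) (trans q≡ (cong (centre v ⊕_)
            (trans (cong ζ* (sym (turns k l))) (cong corner (sym (ℕ.+-suc (l ℕ.* 5 ℕ.+ k) l)))))))
          (trans (g≡ (suc l)) (sym q′≡))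
      where
      turns : ∀ k l → corner ((l ℕ.* 5 ℕ.+ k) ℕ.+ l) ≡ corner k
      turns k l = trans (cong corner (lemma k l)) (corner-*6 l k)
        where
        lemma : ∀ k l → (l ℕ.* 5 ℕ.+ k) ℕ.+ l ≡ l ℕ.* 6 ℕ.+ k
        lemma = ℕsolve-∀
      found : ∃[ g ] ∀ i → act grid g (centre v ⊕ corner (l ℕ.* 5 ℕ.+ k ℕ.+ i)) ≡ centre w ⊕ corner i
      found = fibre (l ℕ.* 5 ℕ.+ k) v w (begin
        fold (shift v o) f (l ℕ.* 5 ℕ.+ k)          ≡⟨ fold-+ (shift v o) f (l ℕ.* 5) ⟩
        fold (develop v k) f (l ℕ.* 5)
          ≡⟨ cong (λ d → fold d f (l ℕ.* 5)) (trans (sym d≡) (trans eq d′≡)) ⟩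
        fold (develop w l) f (l ℕ.* 5)              ≡⟨ fold-+ (shift w o) f (l ℕ.* 5) ⟨
        fold (shift w o) f (l ℕ.* 5 ℕ.+ l)          ≡⟨ cong (fold (shift w o) f) (lemma l) ⟩
        fold (shift w o) f (l ℕ.* 6)                ≡⟨ fold-*6 l (shift w o) ⟩
        shift w o                                   ∎)
        where
        lemma : ∀ l → l ℕ.* 5 ℕ.+ l ≡ l ℕ.* 6
        lemma = ℕsolve-∀
      g : List (ℤ × ℤ)
      g = proj₁ found
      g≡ : ∀ i → act grid g (centre v ⊕ corner (l ℕ.* 5 ℕ.+ k ℕ.+ i)) ≡ centre w ⊕ corner i
      g≡ = proj₂ found

-- Counting orbits

module Orbit (S : Setoid 0ℓ 0ℓ)
  (f : Setoid.Carrier S → Setoid.Carrier S)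
  (f-cong : ∀ {x y} → Setoid._≈_ S x y → Setoid._≈_ S (f x) (f y))
  where
  open Setoid S using (_≈_; Carrier; reflexive) renaming (refl to ≈-refl; sym to ≈-sym; trans to ≈-trans)

  fold-cong : ∀ {x y} k → x ≈ y → fold x f k ≈ fold y f k
  fold-cong zero    x≈y = x≈y
  fold-cong (suc k) x≈y = f-cong (fold-cong k x≈y)

  module _ (k : ℕ)
    (size : ∀ x → fold x f (suc k) ≈ x × (∀ j → 0 ℕ.< j → j ℕ.< suc k → ¬ (fold x f j ≈ x)))
    where

    private
      K : ℕ
      K = suc k

    fold-multiple : ∀ m x → fold x f (m ℕ.* K) ≈ x
    fold-multiple zero    x = ≈-refl
    fold-multiple (suc m) x = ≈-trans (reflexive (fold-+ x f K))
      (≈-trans (proj₁ (size (fold x f (m ℕ.* K)))) (fold-multiple m x))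

    fold-% : ∀ r x → fold x f (r ℕ.% K) ≈ fold x f r
    fold-% r x = ≈-sym (≈-trans (reflexive (trans (cong (fold x f)
        (trans (ℕ.m≡m%n+[m/n]*n r K) (ℕ.+-comm (r ℕ.% K) _))) (fold-+ x f (r ℕ./ K ℕ.* K))))
      (fold-multiple (r ℕ./ K) (fold x f (r ℕ.% K))))

    -- With period `suc k`, a backward step amounts to `k` forward steps, so a zigzag becomes a
    -- forward path.
    reach : ∀ {x y} → EqClosure (λ x y → f x ≈ y) x y → ∃[ r ] fold x f r ≈ y
    reach ε = 0 , ≈-refl
    reach {x} (fwd fx≈z ◅ z~y) with reach z~y
    ... | r , eq = r ℕ.+ 1 , ≈-trans (reflexive (fold-+ x f r)) (≈-trans (fold-cong r fx≈z) eq)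
    reach {x} (_◅_ {j = z} (bwd fz≈x) z~y) with reach z~y
    ... | r , eq = r ℕ.+ k , ≈-trans (reflexive (fold-+ x f r)) (≈-trans (fold-cong r
      (≈-trans (fold-cong k (≈-sym fz≈x))
        (≈-trans (reflexive (fold-suc f z k)) (proj₁ (size z))))) eq)

    connect : ∀ r x → EqClosure (λ x y → f x ≈ y) x (fold x f r)
    connect zero    x = ε
    connect (suc r) x = EqC.transitive _ (connect r x) (EqC.return ≈-refl)

    -- Another `K ∸ i` applications of `f` complete the period and reduce the equation to a return
    -- after `c` steps, which minimality forbids for 0 < `c` < `K`.
    fold-distinct : ∀ x i c → i ℕ.+ c ℕ.< K → fold x f i ≈ fold x f (i ℕ.+ c) → c ≡ 0
    fold-distinct x i zero    _   _  = refl
    fold-distinct x i (suc c) i+c<K eq = contradiction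
      (≈-trans (≈-sym (period (fold x f (suc c))))
        (≈-trans (fold-cong (K ℕ.∸ i) (≈-trans (reflexive (sym (fold-+ x f i))) (≈-sym eq))) (period x)))
      (proj₂ (size x) (suc c) ℕ.z<s (ℕ.≤-<-trans (ℕ.m≤n+m (suc c) i) i+c<K))
      where
      period : ∀ y → fold (fold y f i) f (K ℕ.∸ i) ≈ y
      period y = ≈-trans (reflexive (trans (sym (fold-+ y f (K ℕ.∸ i)))
          (cong (fold y f) (ℕ.m∸n+n≡m (ℕ.<⇒≤ (ℕ.≤-<-trans (ℕ.m≤m+n i (suc c)) i+c<K))))))
        (proj₁ (size y))

    fold-injective-≤ : ∀ x {i j} → i ℕ.≤ j → j ℕ.< K → fold x f i ≈ fold x f j → i ≡ j
    fold-injective-≤ x {i} i≤j j<K eq with ℕ.m≤n⇒∃[o]m+o≡n i≤j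
    ... | c , refl = trans (sym (ℕ.+-identityʳ i)) (cong (i ℕ.+_) (sym (fold-distinct x i c j<K eq)))

    fold-injective : ∀ x i j → i ℕ.< K → j ℕ.< K → fold x f i ≈ fold x f j → i ≡ j
    fold-injective x i j i<K j<K eq with ℕ.≤-total i j
    ... | inj₁ i≤j = fold-injective-≤ x i≤j j<K eq
    ... | inj₂ j≤i = sym (fold-injective-≤ x j≤i i<K (≈-sym eq))

    -- An element corresponds to its orbit and its position counted from the representative of that
    -- orbit. The equality follows from injections in both directions, one from `element-place` and
    -- the other from `element-injective`.
    orbit-count : ∀ {n V} → HasSize S n → HasSize (EqC.setoid (λ x y → f x ≈ y)) V → n ≡ V ℕ.* K
    orbit-count {n} {V} darts orbits = ℕ.≤-antisym
      (Fin.injective⇒≤ {f = encode} encode-injective) (Fin.injective⇒≤ {f = decode} decode-injective)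
      where
      module D = Inverse darts
      module O = Inverse orbits

      position : ∀ x → ∃[ r ] fold (O.from (O.to x)) f r ≈ x
      position x = reach (O.strictlyInverseʳ x)

      respect : ∀ {x y} → x ≈ y → EqClosure (λ x y → f x ≈ y) x y
      respect x≈y = EqC.transitive _ (EqC.return ≈-refl) (EqC.symmetric _ (EqC.return (f-cong (≈-sym x≈y))))

      place : Carrier → Fin V × Fin K
      place x = O.to x , fromℕ< (ℕ.m%n<n (proj₁ (position x)) K)

      element : Fin V × Fin K → Carrier
      element (v , r) = fold (O.from v) f (toℕ r)

      element-place : ∀ x → element (place x) ≈ x
      element-place x = ≈-trans (reflexive (cong (fold (O.from (O.to x)) f) (Fin.toℕ-fromℕ< (ℕ.m%n<n (proj₁ (position x)) K))))
        (≈-trans (fold-% (proj₁ (position x)) _) (proj₂ (position x)))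

      element-injective : ∀ vr ws → element vr ≈ element ws → vr ≡ ws
      element-injective (v , r) (w , s) eq = cong₂ _,_ v≡w (Fin.toℕ-injective
        (fold-injective (O.from v) (toℕ r) (toℕ s) (Fin.toℕ<n r) (Fin.toℕ<n s)
          (subst (λ w → element (v , r) ≈ element (w , s)) (sym v≡w) eq)))
        where
        v≡w : v ≡ w
        v≡w = trans (sym (O.strictlyInverseˡ v)) (trans (O.to-cong
          (EqC.transitive _ (connect (toℕ r) (O.from v)) (EqC.transitive _ (respect eq)
            (EqC.symmetric _ (connect (toℕ s) (O.from w)))))) (O.strictlyInverseˡ w))

      encode : Fin n → Fin (V ℕ.* K)
      encode i = Fin.combine (proj₁ (place (D.from i))) (proj₂ (place (D.from i)))

      encode-injective : ∀ {i j} → encode i ≡ encode j → i ≡ j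
      encode-injective {i} {j} eq = begin
        i                                      ≡⟨ D.strictlyInverseˡ i ⟨
        D.to (D.from i)                        ≡⟨ D.to-cong (element-place (D.from i)) ⟨
        D.to (element (place (D.from i)))
          ≡⟨ cong (λ vr → D.to (element vr)) (uncurry (cong₂ _,_) (Fin.combine-injective _ _ _ _ eq)) ⟩
        D.to (element (place (D.from j)))      ≡⟨ D.to-cong (element-place (D.from j)) ⟩
        D.to (D.from j)                        ≡⟨ D.strictlyInverseˡ j ⟩
        j                                      ∎

      decode : Fin (V ℕ.* K) → Fin n
      decode i = D.to (element (Fin.remQuot K i))

      decode-injective : ∀ {i j} → decode i ≡ decode j → i ≡ j
      decode-injective {i} {j} eq = begin
        i                                              ≡⟨ Fin.combine-remQuot {V} K i ⟨
        uncurry Fin.combine (Fin.remQuot {V} K i)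
          ≡⟨ cong (uncurry Fin.combine) (element-injective _ _
            (≈-trans (≈-sym (D.strictlyInverseʳ _)) (≈-trans (D.from-cong eq) (D.strictlyInverseʳ _)))) ⟩
        uncurry Fin.combine (Fin.remQuot {V} K j)      ≡⟨ Fin.combine-remQuot {V} K j ⟩
        j                                              ∎

any⊎all : ∀ {n} {P Q : Fin n → Set} → (∀ i → P i ⊎ Q i) → (∃[ i ] P i) ⊎ (∀ i → Q i)
any⊎all {zero}  h = inj₂ λ ()
any⊎all {suc n} h with h Fin.zero | any⊎all (λ i → h (Fin.suc i))
... | inj₁ p | _            = inj₁ (Fin.zero , p)
... | inj₂ _ | inj₁ (i , p) = inj₁ (Fin.suc i , p)
... | inj₂ q | inj₂ qs      = inj₂ λ { Fin.zero → q ; (Fin.suc i) → qs i }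

-- Trihexes

module Classification (M : RotationSystem) (isTrihex : IsTrihex M) where
  open RotationSystem M
  open IsTrihex isTrihex
  open Setoid Dart using (reflexive) renaming (refl to ≈-refl; sym to ≈-sym; trans to ≈-trans)
  open Inverse rotation using () renaming (to-cong to σ-cong; from-cong to σ⁻¹-cong; strictlyInverseˡ to σσ⁻¹)

  φ-cong : ∀ {d e} → d ≈ e → φ d ≈ φ e
  φ-cong d≈e = σ⁻¹-cong (α-cong d≈e)

  α-size : ∀ d → OrbitSize α d 2
  α-size d = α-involutive d , λ
    { 1 _ _ → α-free d
    ; (suc (suc _)) _ (ℕ.s≤s (ℕ.s≤s ())) }

  -- With hexagons only, the number of darts is n = 3V = 2E = 6F. Hence 6(V + F) = 2n + n = 6E,
  -- contrary to V + F = E + 2.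
  not-all-hexagons : ¬ (∀ d → OrbitSize φ d 6)
  not-all-hexagons hexagons = contradiction
    (ℕ.+-cancelˡ-≡ (E ℕ.* 6) 0 12 (begin
      E ℕ.* 6 ℕ.+ 0                         ≡⟨ split E ⟩
      E ℕ.* 2 ℕ.* 2 ℕ.+ E ℕ.* 2             ≡⟨ cong (λ n → n ℕ.* 2 ℕ.+ n) n≡2E ⟨
      n ℕ.* 2 ℕ.+ n                         ≡⟨ cong₂ (λ m n → m ℕ.* 2 ℕ.+ n) n≡3V n≡6F ⟩
      V ℕ.* 3 ℕ.* 2 ℕ.+ F ℕ.* 6             ≡⟨ join V F ⟩
      (V ℕ.+ F) ℕ.* 6                       ≡⟨ cong (ℕ._* 6) spherical ⟩
      (E ℕ.+ 2) ℕ.* 6                       ≡⟨ ℕ.*-distribʳ-+ 6 E 2 ⟩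
      E ℕ.* 6 ℕ.+ 12                        ∎)) λ ()
    where
    n : ℕ
    n = proj₁ finite
    n≡3V : n ≡ V ℕ.* 3
    n≡3V = Orbit.orbit-count Dart σ σ-cong 2 cubic (proj₂ finite) #vertices
    n≡2E : n ≡ E ℕ.* 2
    n≡2E = Orbit.orbit-count Dart α α-cong 1 α-size (proj₂ finite) #edges
    n≡6F : n ≡ F ℕ.* 6
    n≡6F = Orbit.orbit-count Dart φ φ-cong 5 hexagons (proj₂ finite) #faces
    split : ∀ e → e ℕ.* 6 ℕ.+ 0 ≡ e ℕ.* 2 ℕ.* 2 ℕ.+ e ℕ.* 2
    split = ℕsolve-∀
    join : ∀ v f → v ℕ.* 3 ℕ.* 2 ℕ.+ f ℕ.* 6 ≡ (v ℕ.+ f) ℕ.* 6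
    join = ℕsolve-∀

  open Inverse (proj₂ finite)

  OrbitSize-cong : ∀ {d e k} → d ≈ e → OrbitSize φ d k → OrbitSize φ e k
  OrbitSize-cong {k = k} d≈e (returns , minimal) =
      ≈-trans (φ-fold k (≈-sym d≈e)) (≈-trans returns d≈e)
    , λ j 0<j j<k eq → minimal j 0<j j<k (≈-trans (φ-fold j d≈e) (≈-trans eq (≈-sym d≈e)))
    where
    φ-fold : ∀ {d e} k → d ≈ e → fold d φ k ≈ fold e φ k
    φ-fold = Orbit.fold-cong Dart φ φ-cong

  triangle : ∃[ d ] OrbitSize φ d 3
  triangle with any⊎all (λ i → face-sides (from i))
  ... | inj₁ (i , size) = from i , size
  ... | inj₂ hexagons   = contradiction
    (λ d → OrbitSize-cong (strictlyInverseʳ d) (hexagons (to d))) not-all-hexagons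

  -- Numbering the darts replaces their setoid equality by a propositional and decidable one, as the
  -- covering construction requires.
  relabel : (∣Dart∣ → ∣Dart∣) → Fin (proj₁ finite) → Fin (proj₁ finite)
  relabel g i = to (g (from i))

  module _ {g : ∣Dart∣ → ∣Dart∣} (g-cong : ∀ {d e} → d ≈ e → g d ≈ g e) where

    relabel-to : ∀ d → relabel g (to d) ≡ to (g d)
    relabel-to d = to-cong (g-cong (strictlyInverseʳ d))

    fold-relabel : ∀ d k → fold (to d) (relabel g) k ≡ to (fold d g k)
    fold-relabel d zero    = refl
    fold-relabel d (suc k) = trans (cong (relabel g) (fold-relabel d k)) (relabel-to (fold d g k))

    relabel-period : ∀ k → (∀ d → fold d g k ≈ d) → ∀ i → fold i (relabel g) k ≡ i
    relabel-period k period i = begin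
      fold i (relabel g) k
        ≡⟨ cong (λ i → fold i (relabel g) k) (strictlyInverseˡ i) ⟨
      fold (to (from i)) (relabel g) k    ≡⟨ fold-relabel (from i) k ⟩
      to (fold (from i) g k)              ≡⟨ to-cong (period (from i)) ⟩
      to (from i)                         ≡⟨ strictlyInverseˡ i ⟩
      i                                   ∎

    relabel-free : (∀ d → ¬ (g d ≈ d)) → ∀ i → relabel g i ≢ i
    relabel-free free i eq = free (from i) (≈-trans (≈-sym (strictlyInverseʳ _)) (from-cong eq))

  φ⁶ : ∀ d → fold d φ 6 ≈ d
  φ⁶ d with face-sides d
  ... | inj₁ (φ³ , _) = ≈-trans (φ-cong (φ-cong (φ-cong φ³))) φ³
  ... | inj₂ (φ⁶ , _) = φ⁶

  φ-free : ∀ d → ¬ (φ d ≈ d)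
  φ-free d with face-sides d
  ... | inj₁ (_ , minimal) = minimal 1 (ℕ.s≤s ℕ.z≤n) (ℕ.s≤s (ℕ.s≤s ℕ.z≤n))
  ... | inj₂ (_ , minimal) = minimal 1 (ℕ.s≤s ℕ.z≤n) (ℕ.s≤s (ℕ.s≤s ℕ.z≤n))

  σ³ : ∀ i → fold i (relabel σ) 3 ≡ i
  σ³ = relabel-period σ-cong 3 (λ d → proj₁ (cubic d))

  α² : ∀ i → fold i (relabel α) 2 ≡ i
  α² = relabel-period α-cong 2 α-involutive

  base : ∣Dart∣
  base = proj₁ triangle

  open Covering (relabel σ) (relabel φ) (relabel α)
    (λ i → to-cong (≈-trans (σ-cong (strictlyInverseʳ _)) (σσ⁻¹ _)))
    σ³ (relabel-period φ-cong 6 φ⁶) α² (relabel-free φ-cong φ-free) (relabel-free α-cong α-free)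
    (to base) (trans (fold-relabel φ-cong base 3) (to-cong (proj₁ (proj₂ triangle))))
  open Quotient basis

  Covered : ∣Dart∣ → Set
  Covered d = ∃[ t ] image t ≡ to d

  covered-base : Covered base
  covered-base = dart (corner 0) (corner 1) ((+ 0 , + 0) , 0 , (+ 0 , + 0 , refl) , refl , refl) , refl

  -- Connectedness makes the covering surjective: a path from `base` is lifted step by step. A
  -- backward σ-step is lifted to two turns, because σ³ = 1, and α is its own inverse.
  covered-step : ∀ {d e} → EqClosure (λ x y → (σ x ≈ y) ⊎ (α x ≈ y)) d e → Covered d → Covered e
  covered-step ε c = c
  covered-step {d} (fwd (inj₁ σd≈e) ◅ path) (t , eq) = covered-step path (turnDart t ,
    trans (image-turn t) (trans (cong (relabel σ) eq) (trans (relabel-to σ-cong d) (to-cong σd≈e))))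
  covered-step {d} (fwd (inj₂ αd≈e) ◅ path) (t , eq) = covered-step path (flipDart t ,
    trans (image-flip t) (trans (cong (relabel α) eq) (trans (relabel-to α-cong d) (to-cong αd≈e))))
  covered-step {d} (_◅_ {j = e} (bwd (inj₁ σe≈d)) path) (t , eq) = covered-step path (turnDart (turnDart t) , (begin
    image (turnDart (turnDart t))                          ≡⟨ image-turn (turnDart t) ⟩
    relabel σ (image (turnDart t))                         ≡⟨ cong (relabel σ) (image-turn t) ⟩
    relabel σ (relabel σ (image t))
      ≡⟨ cong (λ i → relabel σ (relabel σ i)) (trans eq (trans (to-cong (≈-sym σe≈d)) (sym (relabel-to σ-cong e)))) ⟩
    relabel σ (relabel σ (relabel σ (to e)))               ≡⟨ σ³ (to e) ⟩
    to e                                                   ∎))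
  covered-step {d} (_◅_ {j = e} (bwd (inj₂ αe≈d)) path) (t , eq) = covered-step path (flipDart t , (begin
    image (flipDart t)                                     ≡⟨ image-flip t ⟩
    relabel α (image t)
      ≡⟨ cong (relabel α) (trans eq (trans (to-cong (≈-sym αe≈d)) (sym (relabel-to α-cong e)))) ⟩
    relabel α (relabel α (to e))                           ≡⟨ α² (to e) ⟩
    to e                                                   ∎))

  -- The lift depends on the path supplied by `connected`; its orbit does not, by `image-injective`.
  lift : ∣Dart∣ → TilingDart
  lift d = proj₁ (covered-step (connected base d) covered-base)

  image-lift : ∀ d → image (lift d) ≡ to d
  image-lift d = proj₂ (covered-step (connected base d) covered-base)

  -- Two darts of the tiling are in the same orbit exactly when their images agree, so each equation
  -- in the quotient is checked after applying `image`.
  quotient-of-tiling : ∃[ P ] Equivalent M (quotient P)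
  quotient-of-tiling = grid , record
    { darts = record
      { to        = lift
      ; from      = λ t → from (image t)
      ; to-cong   = λ {d} {e} d≈e → image-injective (lift d) (lift e)
          (trans (image-lift d) (trans (to-cong d≈e) (sym (image-lift e))))
      ; from-cong = λ {t} {t′} t≈t′ → from-cong (image-cong t t′ t≈t′)
      ; inverse   =
          (λ {t} {d} d≈ → image-injective (lift d) t
            (trans (image-lift d) (trans (to-cong d≈) (strictlyInverseˡ (image t)))))
        , (λ {d} {t} t≈ → ≈-trans
            (from-cong (trans (image-cong t (lift d) t≈) (image-lift d))) (strictlyInverseʳ d))
      }
    ; commutes-σ = λ d → image-injective (lift (σ d)) (turnDart (lift d)) (begin
        image (lift (σ d))           ≡⟨ image-lift (σ d) ⟩
        to (σ d)                     ≡⟨ relabel-to σ-cong d ⟨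
        relabel σ (to d)             ≡⟨ cong (relabel σ) (image-lift d) ⟨
        relabel σ (image (lift d))   ≡⟨ image-turn (lift d) ⟨
        image (turnDart (lift d))    ∎)
    ; commutes-α = λ d → image-injective (lift (α d)) (flipDart (lift d)) (begin
        image (lift (α d))           ≡⟨ image-lift (α d) ⟩
        to (α d)                     ≡⟨ relabel-to α-cong d ⟨
        relabel α (to d)             ≡⟨ cong (relabel α) (image-lift d) ⟨
        relabel α (image (lift d))   ≡⟨ image-flip (lift d) ⟨
        image (flipDart (lift d))    ∎)
    }

theorem4p1 : (T : Trihex) → ∃[ P ] Equivalent (proj₁ T) (quotient P)
theorem4p1 (M , isTrihex) = Classification.quotient-of-tiling M isTrihex
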